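{- For a one-move rider $\mathbb{P}$ with basic move $(c,d)$, where $c,d$ are relatively prime integers, the period of $u_{\mathbb{P}}(q;n,n)$, as a quasipolynomial in $n$ for fixed $q$, is exactly $\max(|c|,|d|)$.
   Context: A one-move rider with basic move $(c,d)$ (move set $\mathbf{M}=\{(c,d)\}$, with $c,d$ relatively prime) is a piece that, from a lattice point $z\in\mathbb{Z}^2$, attacks every lattice point $z+k(c,d)$ with $k\in\mathbb{Z}$, $k\ne 0$. For positive integers $m,n$, the $m\times n$ board is $\{1,\dots,m\}\times\{1,\dots,n\}\subset\mathbb{Z}^2$. $u_{\mathbb{P}}(q;m,n)$ denotes the number of nonattacking configurations of $q$ unlabelled pieces $\mathbb{P}$ on the $m\times n$ board, i.e. the number of $q$-element subsets of the board in which no point is attacked by a piece placed at another point of the subset; $u_{\mathbb{P}}(q;n,n)$ is the case of the square board. Here $q$ is the number of pieces. A function $f$ on the positive integers is a quasipolynomial if there are a positive integer $p$ and polynomials $f_0,\dots,f_{p-1}\in\mathbb{Q}[t]$ such that $f(n)=f_{r}(n)$ whenever $n\equiv r \pmod p$ with $0\le r<p$. The period of $f$ is the smallest such $p$.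
   Formalization: The number of pieces q is assumed to be at least 2: for q = 0 and q = 1 the count is 1 or n², which has period 1, so the claim as stated fails there whenever max(|c|,|d|) > 1. -}

module Defs where

open import Data.Fin.Base using (Fin)
open import Data.Integer.Base as ℤ using (ℤ; +_; 0ℤ; 1ℤ)
import Data.Integer.Properties as ℤ
open import Data.Integer.Divisibility.Signed using (_∣?_; divides)
open import Data.List.Base
  using (List; []; _∷_; _++_; map; foldr; filter; length; upTo; cartesianProduct)
open import Data.List.Relation.Unary.All using (All; all?)
open import Data.Nat.Base as ℕ using (ℕ; zero; suc)
open import Data.Nat.DivMod using (_mod_)
open import Data.Product.Base using (Σ-syntax; ∃-syntax; _×_; _,_; proj₁; proj₂)
open import Data.Product.Properties using (≡-dec)
open import Data.Rational.Base as ℚ using (ℚ; 0ℚ)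
open import Relation.Binary.Definitions using (DecidableEquality)
open import Relation.Binary.PropositionalEquality
  using (_≡_; _≢_; refl; sym; trans; cong; cong₂; subst)
open import Relation.Nullary.Decidable
  using (Dec; yes; no; ¬?; _×-dec_; _→-dec_)
open import Relation.Nullary.Negation using (¬_)

Point : Set
Point = ℤ × ℤ

_≟ₚ_ : DecidableEquality Point
_≟ₚ_ = ≡-dec ℤ._≟_ ℤ._≟_

shift : Point → ℤ → Point → Point
shift (x , y) k (c , d) = x ℤ.+ k ℤ.* c , y ℤ.+ k ℤ.* d

-- The rider with basic move m, standing on z, attacks w.
Attacks : (m z w : Point) → Set
Attacks m z w = ∃[ k ] (k ≢ 0ℤ × w ≡ shift z k m)

private
  AttacksBy : (m z w : Point) → ℤ → Set
  AttacksBy m z w k = k ≢ 0ℤ × w ≡ shift z k m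

  attacksBy? : ∀ m z w k → Dec (AttacksBy m z w k)
  attacksBy? m z w k = ¬? (k ℤ.≟ 0ℤ) ×-dec (w ≟ₚ shift z k m)

  difference : ∀ x a y → y ≡ x ℤ.+ a → a ≡ y ℤ.- x
  difference x a y refl =
    sym (trans (cong (ℤ._- x) (ℤ.+-comm x a))
        (trans (ℤ.+-assoc a x (ℤ.- x))
        (trans (cong (λ v → a ℤ.+ v) (ℤ.+-inverseʳ x)) (ℤ.+-identityʳ a))))

  -- If e ≢ 0 and P k forces k * e ≡ a, the only candidate witness is a / e.
  search : (P : ℤ → Set) → (∀ k → Dec (P k)) → ∀ e a → e ≢ 0ℤ →
           (∀ k → P k → k ℤ.* e ≡ a) → Dec (∃[ k ] P k)
  search P P? e a e≢0 forced with e ∣? a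
  ... | no e∤a = no λ (k , Pk) → e∤a (divides k (sym (forced k Pk)))
  ... | yes (divides k₀ a≡k₀e) with P? k₀
  ...   | yes Pk₀ = yes (k₀ , Pk₀)
  ...   | no ¬Pk₀ = no λ (k , Pk) → ¬Pk₀ (subst P
            (ℤ.*-cancelʳ-≡ k k₀ e {{ℤ.≢-nonZero e≢0}} (trans (forced k Pk) a≡k₀e)) Pk)

attacks? : ∀ m z w → Dec (Attacks m z w)
attacks? (c , d) (x , y) w with c ℤ.≟ 0ℤ
... | no c≢0 = search (AttacksBy (c , d) (x , y) w) (attacksBy? (c , d) (x , y) w)
      c (proj₁ w ℤ.- x) c≢0
      λ k (_ , eq) → difference x (k ℤ.* c) (proj₁ w) (cong proj₁ eq)
... | yes refl with d ℤ.≟ 0ℤ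
...   | no d≢0 = search (AttacksBy (c , d) (x , y) w) (attacksBy? (c , d) (x , y) w)
        d (proj₂ w ℤ.- y) d≢0
        λ k (_ , eq) → difference y (k ℤ.* d) (proj₂ w) (cong proj₂ eq)
...   | yes refl with w ≟ₚ shift (x , y) 1ℤ (0ℤ , 0ℤ)
...     | yes eq = yes (1ℤ , (λ ()) , eq)
...     | no neq = no λ (k , _ , eq) → neq (trans eq
          (cong₂ (λ a b → x ℤ.+ a , y ℤ.+ b) (ℤ.*-zeroʳ k) (ℤ.*-zeroʳ k)))

Nonattacking : Point → List Point → Set
Nonattacking m S = All (λ z → All (λ w → z ≢ w → ¬ Attacks m z w) S) S

nonattacking? : ∀ m S → Dec (Nonattacking m S)
nonattacking? m S =
  all? (λ z → all? (λ w → ¬? (z ≟ₚ w) →-dec ¬? (attacks? m z w)) S) S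

-- The integers 1, …, n.
range : ℕ → List ℤ
range n = map (λ i → + suc i) (upTo n)

board : ℕ → ℕ → List Point
board m n = cartesianProduct (range m) (range n)

-- All sublists of length q.  For a list without repetitions, such as a board,
-- these enumerate the q-element subsets of its entries, each exactly once.
choose : ∀ {A : Set} → ℕ → List A → List (List A)
choose zero    _        = [] ∷ []
choose (suc q) []       = []
choose (suc q) (x ∷ xs) = map (x ∷_) (choose q xs) ++ choose (suc q) xs

-- u move q m n counts the nonattacking placements of q unlabelled one-move
-- riders on the m × n board.
u : Point → ℕ → ℕ → ℕ → ℕ
u move q m n = length (filter (nonattacking? move) (choose q (board m n)))

fromℕ : ℕ → ℚ
fromℕ n = + n ℚ./ 1

-- Polynomials in ℚ[t] as coefficient lists, constant term first; trailing
-- zeros are allowed, since only the values of a polynomial are used.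
Polynomial : Set
Polynomial = List ℚ

eval : Polynomial → ℚ → ℚ
eval f t = foldr (λ a v → a ℚ.+ t ℚ.* v) 0ℚ f

-- f agrees on the positive integers with one polynomial per residue class
-- modulo p, where p is positive.
IsQuasipolynomialMod : (ℕ → ℚ) → ℕ → Set
IsQuasipolynomialMod f p =
  Σ[ p≢0 ∈ ℕ.NonZero p ] Σ[ fs ∈ (Fin p → Polynomial) ]
    (∀ n → 1 ℕ.≤ n → f n ≡ eval (fs (_mod_ n p {{p≢0}})) (fromℕ n))

-- f is a quasipolynomial and p is its period.
HasPeriod : (ℕ → ℚ) → ℕ → Set
HasPeriod f p =
  IsQuasipolynomialMod f p × (∀ p′ → IsQuasipolynomialMod f p′ → p ℕ.≤ p′)

module Submission where

-- Fix q and write e_q for the number of q-sets of board points no two of which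
-- lie on a common line in direction (c , d).  By Newton's identities e_q is a
-- polynomial in the power sums Σ_L |L| ^ (j + 1) over these lines L.  Let a ≤ M
-- be |c| and |d| in order.  Since (n ∸ k a) (n ∸ k M) points z of the board
-- have z + k (c , d) on the board, summation by parts gives the power sum as
--   n² + Σ_k w_j(k) (n ∸ k a) (n ∸ k M),
-- where w_j is the second difference of k ^ (j + 1).  The summands vanish from
-- k = n / M on, so for n ≡ r (mod M) the sum is a polynomial in n, by which M is
-- a period.  In terms of x = n / M and y = x - k, solving
-- V (x , y) - V (x , y + 1) = summand turns it into V (x , r / M) - V (x , x).
-- Hence the polynomials for r and for 0 differ only in degrees up to j; for
-- j = 1 the leading coefficient of the difference is a positive multiple of
-- r (M - r) (M - a).  Through Newton's identities this makes the constituents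
-- of e_q for 0 and for 0 < r < M differ in degree 2 q - 3, whereas a period
-- p < M would identify those for 0 and p.

open import Defs
open import Data.Fin.Base using (Fin; toℕ)
open import Data.Fin.Properties using (toℕ-injective; toℕ-fromℕ<)
open import Data.Empty using (⊥)
open import Data.Integer.Base as ℤ using (ℤ; ∣_∣; 0ℤ; 1ℤ; -[1+_]) renaming (+_ to pos)
open import Data.Integer.Coprimality using (Coprime)
import Data.Integer.Properties as ℤ
import Data.Integer.Tactic.RingSolver as ℤ
open import Data.List.Base
  using (List; []; _∷_; _++_; map; filter; length; applyUpTo; upTo; cartesianProduct)
open import Data.List.Properties using (filter-accept; filter-reject; filter-++; filter-≐; length-++)
open import Data.List.Relation.Unary.All as All using (All; []; _∷_; all?)
import Data.List.Relation.Unary.All.Properties as All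
open import Data.List.Relation.Unary.AllPairs as AllPairs using (AllPairs; []; _∷_)
import Data.List.Relation.Unary.AllPairs.Properties as AllPairs
open import Data.Maybe.Base using (Maybe; just; nothing)
open import Data.Nat.Base as ℕ using (ℕ; zero; suc; s≤s; z≤n; _≤_; _⊔_)
import Data.Nat.Coprimality as ℕ using (Coprime; sym)
open import Data.Nat.Divisibility using (∣-refl; _∣0)
open import Data.Nat.DivMod using (_/_; _%_; _mod_; m≡m%n+[m/n]*n; m%n<n; m*n%n≡0)
import Data.Nat.Properties as ℕ
open import Data.Product.Base using (Σ-syntax; ∃-syntax; _×_; _,_; proj₁; proj₂)
open import Data.Rational.Base
  using (ℚ; 0ℚ; 1ℚ; ½; _+_; _*_; _-_; -_; 1/_; _<_; toℚᵘ; NonZero; Positive; positive; ≢-nonZero)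
open import Data.Rational.Properties
import Data.Rational.Unnormalised.Base as ℚᵘ
import Data.Rational.Unnormalised.Properties as ℚᵘ
open import Data.Sum.Base using (_⊎_; inj₁; inj₂)
open import Level using (0ℓ)
open import Relation.Binary.Definitions using (tri<; tri≈; tri>)
open import Relation.Binary.PropositionalEquality
open import Relation.Nullary using (Dec; yes; no; ¬_; contradiction)
open import Relation.Nullary.Decidable using (¬?; _×-dec_)
open import Tactic.RingSolver using (solve-∀)
open import Tactic.RingSolver.Core.AlmostCommutativeRing
  using (AlmostCommutativeRing; fromCommutativeRing)

-- Natural numbers in ℚ

-- Why degree 2 q - 3 decides: p_j has degree j + 2, its difference between two residue classes only
-- degree j, and p_0 = n ^ 2 does not change at all. A monomial of e_q is a product of power sums
-- p_j whose numbers j + 1 add up to q. Its degree is q plus the number of factors, and the degree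
-- of its difference is at least two lower. As p_0 ^ q does not change, the difference of e_q has
-- degree at most 2 q - 3, and only p_0 ^ (q - 2) p_1 reaches it, with a negative coefficient in
-- e_q. Carrying this sign through Newton's recursion excludes cancellation. For q < 2 the counts
-- are 1 and n ^ 2, so q starts at 2. Degree bounds carry a coefficient that may be zero: terms of
-- lower degree are raised to the common bound instead of being treated by cases. The factor M - a
-- vanishes only for a = M; coprimality then gives M = 1, which is trivially minimal.

ring : AlmostCommutativeRing 0ℓ 0ℓ
ring = fromCommutativeRing +-*-commutativeRing isZero?
  where
  isZero? : ∀ p → Maybe (0ℚ ≡ p)
  isZero? p with 0ℚ ≟ p
  ... | yes eq = just eq
  ... | no  _  = nothing

fromℕ-+ : ∀ m n → fromℕ (m ℕ.+ n) ≡ fromℕ m + fromℕ n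
fromℕ-+ m n = toℚᵘ-injective (begin
  toℚᵘ (fromℕ (m ℕ.+ n))                  ≈⟨ toℚᵘ-fromℚᵘ (ℚᵘ.mkℚᵘ (pos (m ℕ.+ n)) 0) ⟩
  ℚᵘ.mkℚᵘ (pos (m ℕ.+ n)) 0                 ≈⟨ ℚᵘ.*≡* (cong (ℤ._* pos 1) numerators) ⟩
  ℚᵘ.mkℚᵘ (pos m) 0 ℚᵘ.+ ℚᵘ.mkℚᵘ (pos n) 0    ≈⟨ ℚᵘ.+-cong (toℚᵘ-fromℚᵘ (ℚᵘ.mkℚᵘ (pos m) 0)) (toℚᵘ-fromℚᵘ (ℚᵘ.mkℚᵘ (pos n) 0)) ⟨
  toℚᵘ (fromℕ m) ℚᵘ.+ toℚᵘ (fromℕ n)      ≈⟨ toℚᵘ-homo-+ (fromℕ m) (fromℕ n) ⟨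
  toℚᵘ (fromℕ m + fromℕ n)                ∎)
  where
  open import Relation.Binary.Reasoning.Setoid ℚᵘ.≃-setoid
  numerators : pos (m ℕ.+ n) ≡ pos m ℤ.* pos 1 ℤ.+ pos n ℤ.* pos 1
  numerators = trans (ℤ.pos-+ m n) (sym (cong₂ ℤ._+_ (ℤ.*-identityʳ (pos m)) (ℤ.*-identityʳ (pos n))))

fromℕ-suc : ∀ n → fromℕ (suc n) ≡ 1ℚ + fromℕ n
fromℕ-suc = fromℕ-+ 1

fromℕ-* : ∀ m n → fromℕ (m ℕ.* n) ≡ fromℕ m * fromℕ n
fromℕ-* zero    n = sym (*-zeroˡ (fromℕ n))
fromℕ-* (suc m) n = begin
  fromℕ (n ℕ.+ m ℕ.* n)              ≡⟨ fromℕ-+ n (m ℕ.* n) ⟩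
  fromℕ n + fromℕ (m ℕ.* n)          ≡⟨ cong (fromℕ n +_) (fromℕ-* m n) ⟩
  fromℕ n + fromℕ m * fromℕ n        ≡⟨ lemma (fromℕ m) (fromℕ n) ⟩
  (1ℚ + fromℕ m) * fromℕ n           ≡⟨ cong (_* fromℕ n) (fromℕ-suc m) ⟨
  fromℕ (suc m) * fromℕ n            ∎
  where
  open ≡-Reasoning
  lemma : ∀ a b → b + a * b ≡ (1ℚ + a) * b
  lemma = solve-∀ ring

fromℕ-∸ : ∀ {m n} → n ℕ.≤ m → fromℕ (m ℕ.∸ n) ≡ fromℕ m - fromℕ n
fromℕ-∸ {m} {n} n≤m = begin
  fromℕ (m ℕ.∸ n)                          ≡⟨ lemma (fromℕ (m ℕ.∸ n)) (fromℕ n) ⟩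
  (fromℕ (m ℕ.∸ n) + fromℕ n) - fromℕ n    ≡⟨ cong (_- fromℕ n) (fromℕ-+ (m ℕ.∸ n) n) ⟨
  fromℕ (m ℕ.∸ n ℕ.+ n) - fromℕ n          ≡⟨ cong (λ k → fromℕ k - fromℕ n) (ℕ.m∸n+n≡m n≤m) ⟩
  fromℕ m - fromℕ n                        ∎
  where
  open ≡-Reasoning
  lemma : ∀ a b → a ≡ (a + b) - b
  lemma = solve-∀ ring

0<1 : 0ℚ < 1ℚ
0<1 = positive⁻¹ 1ℚ

0<fromℕ-suc : ∀ n → 0ℚ < fromℕ (suc n)
0<fromℕ-suc n = positive⁻¹ (fromℕ (suc n)) {{normalize-pos (suc n) 1}}

0≢fromℕ-suc : ∀ n → 0ℚ ≢ fromℕ (suc n)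
0≢fromℕ-suc n = <⇒≢ (0<fromℕ-suc n)

fromℕ-injective : ∀ {m n} → fromℕ m ≡ fromℕ n → m ≡ n
fromℕ-injective {zero}  {zero}  _  = refl
fromℕ-injective {zero}  {suc n} eq = contradiction eq (0≢fromℕ-suc n)
fromℕ-injective {suc m} {zero}  eq = contradiction (sym eq) (0≢fromℕ-suc m)
fromℕ-injective {suc m} {suc n} eq = cong suc (fromℕ-injective
  (+-cancelˡ 1ℚ (fromℕ m) (fromℕ n) (trans (sym (fromℕ-suc m)) (trans eq (fromℕ-suc n)))))
  where
  +-cancelˡ : ∀ a b c → a + b ≡ a + c → b ≡ c
  +-cancelˡ a b c e = trans (lemma a b) (trans (cong (- a +_) e) (sym (lemma a c)))
    where
    lemma : ∀ a b → b ≡ - a + (a + b)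
    lemma = solve-∀ ring

0<p*q : ∀ {p q} → 0ℚ < p → 0ℚ < q → 0ℚ < p * q
0<p*q {p} {q} 0<p 0<q = positive⁻¹ (p * q) {{pos*pos⇒pos p {{positive 0<p}} q {{positive 0<q}}}}

0<p+q : ∀ {p q} → 0ℚ < p → 0ℚ < q → 0ℚ < p + q
0<p+q = +-mono-<

inverse : ∀ p → 0ℚ < p → ∃[ q ] (0ℚ < q × p * q ≡ 1ℚ)
inverse p 0<p = 1/ p , positive⁻¹ (1/ p) {{1/pos⇒pos p}} , *-inverseʳ p
  where instance
  p-positive : Positive p
  p-positive = positive 0<p
  p-nonZero : NonZero p
  p-nonZero = pos⇒nonZero p

recip : ℕ → ℚ
recip n = proj₁ (inverse (fromℕ (suc n)) (0<fromℕ-suc n))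

0<recip : ∀ n → 0ℚ < recip n
0<recip n = proj₁ (proj₂ (inverse (fromℕ (suc n)) (0<fromℕ-suc n)))

recip-inverse : ∀ n → fromℕ (suc n) * recip n ≡ 1ℚ
recip-inverse n = proj₂ (proj₂ (inverse (fromℕ (suc n)) (0<fromℕ-suc n)))

p-q≡0⇒p≡q : ∀ p q → p - q ≡ 0ℚ → p ≡ q
p-q≡0⇒p≡q p q eq = trans (lemma p q) (trans (cong (_+ q) eq) (+-identityˡ q))
  where
  lemma : ∀ a b → a ≡ (a - b) + b
  lemma = solve-∀ ring

p*q≡0⇒q≡0 : ∀ p q → p ≢ 0ℚ → p * q ≡ 0ℚ → q ≡ 0ℚ
p*q≡0⇒q≡0 p q p≢0 eq = begin
  q                 ≡⟨ *-identityˡ q ⟨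
  1ℚ * q            ≡⟨ cong (_* q) (*-inverseˡ p) ⟨
  1/ p * p * q      ≡⟨ *-assoc (1/ p) p q ⟩
  1/ p * (p * q)    ≡⟨ cong (1/ p *_) eq ⟩
  1/ p * 0ℚ         ≡⟨ *-zeroʳ (1/ p) ⟩
  0ℚ                ∎
  where
  open ≡-Reasoning
  instance
    p-nonZero : NonZero p
    p-nonZero = ≢-nonZero p≢0

-- Polynomial functions and their leading coefficients

-- Lead d a h: h is a polynomial function of degree at most d whose
-- coefficient of t ^ d is a, presented in Horner form.
data Lead : ℕ → ℚ → (ℚ → ℚ) → Set where
  const  : ∀ {a h} → (∀ t → h t ≡ a) → Lead 0 a h
  horner : ∀ {d a g h} b → Lead d a g → (∀ t → h t ≡ b + t * g t) → Lead (suc d) a h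

Lead-resp : ∀ {d d′ a a′ g h} → d′ ≡ d → a′ ≡ a → (∀ t → h t ≡ g t) → Lead d a g → Lead d′ a′ h
Lead-resp refl refl h≗g (const eq)      = const λ t → trans (h≗g t) (eq t)
Lead-resp refl refl h≗g (horner b l eq) = horner b l λ t → trans (h≗g t) (eq t)

Lead-+ : ∀ {d a b g h} → Lead d a g → Lead d b h → Lead d (a + b) (λ t → g t + h t)
Lead-+ (const eq) (const eq′) = const λ t → cong₂ _+_ (eq t) (eq′ t)
Lead-+ (horner {g = g} b l eq) (horner {g = g′} b′ l′ eq′) = horner (b + b′) (Lead-+ l l′) λ t →
  trans (cong₂ _+_ (eq t) (eq′ t)) (lemma b b′ t (g t) (g′ t))
  where
  lemma : ∀ b b′ t x y → (b + t * x) + (b′ + t * y) ≡ (b + b′) + t * (x + y)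
  lemma = solve-∀ ring

Lead-scale : ∀ {d a h} s → Lead d a h → Lead d (s * a) (λ t → s * h t)
Lead-scale s (const eq) = const λ t → cong (s *_) (eq t)
Lead-scale s (horner {g = g} b l eq) = horner (s * b) (Lead-scale s l) λ t →
  trans (cong (s *_) (eq t)) (lemma s b t (g t))
  where
  lemma : ∀ s b t x → s * (b + t * x) ≡ s * b + t * (s * x)
  lemma = solve-∀ ring

Lead-- : ∀ {d a b g h} → Lead d a g → Lead d b h → Lead d (a - b) (λ t → g t - h t)
Lead-- {a = a} {b} {g} {h} l l′ = Lead-resp refl (lemma a b) (λ t → lemma (g t) (h t))
  (Lead-+ l (Lead-scale (- 1ℚ) l′))
  where
  lemma : ∀ x y → x - y ≡ x + (- 1ℚ) * y
  lemma = solve-∀ ring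

Lead-raise : ∀ {d a h} → Lead d a h → Lead (suc d) 0ℚ h
Lead-raise {a = a} (const eq) = horner a (const λ _ → refl) λ t →
  trans (eq t) (sym (trans (cong (a +_) (*-zeroʳ t)) (+-identityʳ a)))
Lead-raise (horner b l eq) = horner b (Lead-raise l) eq

Lead-< : ∀ {d e a h} → d ℕ.< e → Lead d a h → Lead e 0ℚ h
Lead-< {d} d<e = go (ℕ.≤⇒≤′ d<e)
  where
  go : ∀ {e a h} → suc d ℕ.≤′ e → Lead d a h → Lead e 0ℚ h
  go ℕ.≤′-refl       l = Lead-raise l
  go (ℕ.≤′-step d<e) l = Lead-raise (go d<e l)

Lead-const : ∀ a → Lead 0 a (λ _ → a)
Lead-const a = const λ _ → refl

Lead-0 : ∀ d → Lead d 0ℚ (λ _ → 0ℚ)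
Lead-0 zero    = Lead-const 0ℚ
Lead-0 (suc d) = Lead-raise (Lead-0 d)

Lead-var : ∀ {d a g} → Lead d a g → Lead (suc d) a (λ t → t * g t)
Lead-var {g = g} l = horner 0ℚ l λ t → sym (+-identityˡ (t * g t))

Lead-* : ∀ {d e a b g h} → Lead d a g → Lead e b h → Lead (d ℕ.+ e) (a * b) (λ t → g t * h t)
Lead-* {a = a} {h = h} (const eq) l = Lead-resp refl refl (λ t → cong (_* h t) (eq t)) (Lead-scale a l)
Lead-* {d = suc d} {e} {a} {b} {h = h} (horner {g = g} c l eq) l′ = Lead-resp refl (a*b≡0+a*b a b)
  (λ t → trans (cong (_* h t) (eq t)) (lemma c t (g t) (h t)))
  (Lead-+ (Lead-scale c (Lead-< (s≤s (ℕ.m≤n+m e d)) l′)) (Lead-var (Lead-* l l′)))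
  where
  a*b≡0+a*b : ∀ a b → a * b ≡ c * 0ℚ + a * b
  a*b≡0+a*b a b = sym (trans (cong (_+ a * b) (*-zeroʳ c)) (+-identityˡ (a * b)))
  lemma : ∀ c t x y → (c + t * x) * y ≡ c * y + t * (x * y)
  lemma = solve-∀ ring

Lead-dilate : ∀ {d a h} s → Lead d a h → ∃[ b ] Lead d b (λ t → h (s * t))
Lead-dilate s (const eq) = _ , const λ t → eq (s * t)
Lead-dilate s (horner {g = g} b l eq) =
  let _ , l′ = Lead-dilate s l in
  _ , horner b (Lead-scale s l′) λ t → trans (eq (s * t)) (lemma s b t (g (s * t)))
  where
  lemma : ∀ s b t x → b + (s * t) * x ≡ b + t * (s * x)
  lemma = solve-∀ ring

Lead-shift : ∀ {d a h} s → Lead d a h → Lead d a (λ t → h (t + s))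
Lead-shift s (const eq) = const λ t → eq (t + s)
Lead-shift {suc d} {a} s (horner {g = g} b l eq) = Lead-resp refl (lemma₁ s a)
  (λ t → trans (eq (t + s)) (lemma s b t (g (t + s))))
  (Lead-+ (horner b (Lead-shift s l) λ t → refl) (Lead-scale s (Lead-raise (Lead-shift s l))))
  where
  lemma : ∀ s b t x → b + (t + s) * x ≡ (b + t * x) + s * x
  lemma = solve-∀ ring
  lemma₁ : ∀ s a → a ≡ a + s * 0ℚ
  lemma₁ = solve-∀ ring

-- Discrete product rule: the difference of b + t g(t) is g(t + 1) + t (g(t + 1) - g(t)), so every
-- Horner layer adds one more copy of `a`.
Lead-difference : ∀ {d a h} → Lead (suc d) a h → Lead d (fromℕ (suc d) * a) (λ t → h (t + 1ℚ) - h t)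
Lead-difference {zero} {a} (horner {g = g} b (const eq′) eq) = const λ t →
  trans (cong₂ _-_ (trans (eq (t + 1ℚ)) (cong (λ v → b + (t + 1ℚ) * v) (eq′ (t + 1ℚ))))
                   (trans (eq t) (cong (λ v → b + t * v) (eq′ t))))
        (lemma b t a)
  where
  lemma : ∀ b t x → (b + (t + 1ℚ) * x) - (b + t * x) ≡ 1ℚ * x
  lemma = solve-∀ ring
Lead-difference {suc d} {a} (horner {g = g} b l eq) = Lead-resp refl
  (trans (cong (_* a) (fromℕ-suc (suc d))) (distrib (fromℕ (suc d)) a))
  (λ t → trans (cong₂ _-_ (eq (t + 1ℚ)) (eq t)) (lemma b t (g (t + 1ℚ)) (g t)))
  (Lead-+ (Lead-shift 1ℚ l) (Lead-var (Lead-difference l)))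
  where
  distrib : ∀ x a → (1ℚ + x) * a ≡ a + x * a
  distrib = solve-∀ ring
  lemma : ∀ b t x y → (b + (t + 1ℚ) * x) - (b + t * y) ≡ x + t * (x - y)
  lemma = solve-∀ ring

Lead-drop : ∀ {d h} → Lead (suc d) 0ℚ h → ∃[ a ] Lead d a h
Lead-drop {zero} (horner b (const eq′) eq) = b , const λ t →
  trans (eq t) (trans (cong (λ v → b + t * v) (eq′ t)) (trans (cong (b +_) (*-zeroʳ t)) (+-identityʳ b)))
Lead-drop {suc d} (horner b l eq) = let _ , l′ = Lead-drop l in _ , horner b l′ eq

pow : ℕ → ℚ → ℚ
pow zero    t = 1ℚ
pow (suc d) t = t * pow d t

Lead-pow : ∀ d → Lead d 1ℚ (pow d)
Lead-pow zero    = Lead-const 1ℚ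
Lead-pow (suc d) = Lead-var (Lead-pow d)

-- The difference of t ^ (d + 1) has leading coefficient d + 1, so subtracting a / (d + 1) times it
-- leaves a remainder of lower degree, or zero when d = 0. The orientation H t - H (t + 1) suits
-- sums whose argument y = x - k falls as k grows.
antidifference : ∀ d {a h} → Lead d a h →
  Σ[ H ∈ (ℚ → ℚ) ] (∀ t → H t - H (t + 1ℚ) ≡ h t) × ∃[ b ] Lead (suc d) b H
antidifference d {a} {h} l = H , telescope , _ , Lead-- lH′ (Lead-scale s (Lead-pow (suc d)))
  where
  s = a * recip d
  Δ : ℚ → ℚ
  Δ t = pow (suc d) (t + 1ℚ) - pow (suc d) t
  rest : ℚ → ℚ
  rest t = h t - s * Δ t
  cancel : 0ℚ ≡ a - s * (fromℕ (suc d) * 1ℚ)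
  cancel = sym (trans (lemma a (recip d) (fromℕ (suc d)))
    (trans (cong (λ v → a - a * v) (recip-inverse d))
    (trans (cong (λ v → a - v) (*-identityʳ a)) (+-inverseʳ a))))
    where
    lemma : ∀ a r n → a - (a * r) * (n * 1ℚ) ≡ a - a * (n * r)
    lemma = solve-∀ ring
  l-rest : Lead d 0ℚ rest
  l-rest = Lead-resp refl cancel (λ t → refl) (Lead-- l (Lead-scale s (Lead-difference (Lead-pow (suc d)))))
  below : ∀ d → Lead d 0ℚ rest →
    Σ[ H ∈ (ℚ → ℚ) ] (∀ t → H t - H (t + 1ℚ) ≡ rest t) × ∃[ b ] Lead (suc d) b H
  below zero    (const eq) = (λ _ → 0ℚ) , (λ t → sym (eq t)) , 0ℚ , Lead-0 1
  below (suc d) l₀ =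
    let H , e , _ , lH = antidifference d (proj₂ (Lead-drop l₀))
    in  H , e , 0ℚ , Lead-raise lH
  H′ = proj₁ (below d l-rest)
  lH′ = proj₂ (proj₂ (proj₂ (below d l-rest)))
  H : ℚ → ℚ
  H t = H′ t - s * pow (suc d) t
  telescope : ∀ t → H t - H (t + 1ℚ) ≡ h t
  telescope t = trans (lemma (H′ t) (H′ (t + 1ℚ)) s (pow (suc d) t) (pow (suc d) (t + 1ℚ)))
    (trans (cong (_+ s * Δ t) (proj₁ (proj₂ (below d l-rest)) t)) (lemma₂ (h t) (s * Δ t)))
    where
    lemma : ∀ x y s p q → (x - s * p) - (y - s * q) ≡ (x - y) + s * (q - p)
    lemma = solve-∀ ring
    lemma₂ : ∀ x y → (x - y) + y ≡ x
    lemma₂ = solve-∀ ring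

coefficients : ∀ {d a h} → Lead d a h → Σ[ f ∈ Polynomial ] ∀ t → eval f t ≡ h t
coefficients {a = a} (const eq) = a ∷ [] , λ t →
  trans (cong (a +_) (*-zeroʳ t)) (trans (+-identityʳ a) (sym (eq t)))
coefficients (horner b l eq) =
  let f , e = coefficients l in b ∷ f , λ t → trans (cong (λ v → b + t * v) (e t)) (sym (eq t))

Lead-eval : ∀ f → ∃[ d ] ∃[ a ] Lead d a (eval f)
Lead-eval []      = 0 , 0ℚ , Lead-0 0
Lead-eval (a ∷ f) = let d , b , l = Lead-eval f in suc d , b , horner a l λ t → refl

-- Synthetic division: t g(t) = (t - r) g(t) + r g(t), and the last term is divided recursively. Its
-- quotient has lower degree, so the leading coefficient stays `a`.
factor : ∀ {d a h} r → Lead (suc d) a h → Σ[ k ∈ (ℚ → ℚ) ] Lead d a k × (∀ t → h t ≡ h r + (t - r) * k t)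
factor {zero} {a} {h} r (horner {g = g} b (const eq′) eq) = g , const eq′ , λ t →
  trans (eq t) (trans (cong (λ v → b + t * v) (eq′ t))
  (trans (lemma b t r a) (cong₂ _+_ (trans (cong (λ v → b + r * v) (sym (eq′ r))) (sym (eq r))) (cong ((t - r) *_) (sym (eq′ t))))))
  where
  lemma : ∀ b t r a → b + t * a ≡ (b + r * a) + (t - r) * a
  lemma = solve-∀ ring
factor {suc d} {a} {h} r (horner {g = g} b l eq) with factor r l
... | k , lk , e = (λ t → g t + r * k t) ,
  Lead-resp refl (lemma₀ a r) (λ t → refl) (Lead-+ l (Lead-scale r (Lead-raise lk))) , λ t →
  trans (eq t) (trans (lemma₁ b t r (g t)) (trans (cong (λ v → b + (t - r) * g t + r * v) (e t))
  (trans (lemma₂ b t r (g t) (g r) (k t)) (cong (_+ (t - r) * (g t + r * k t)) (sym (eq r))))))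
  where
  lemma₀ : ∀ a r → a ≡ a + r * 0ℚ
  lemma₀ = solve-∀ ring
  lemma₁ : ∀ b t r x → b + t * x ≡ b + (t - r) * x + r * x
  lemma₁ = solve-∀ ring
  lemma₂ : ∀ b t r x y k → b + (t - r) * x + r * (y + (t - r) * k) ≡ (b + r * y) + (t - r) * (x + r * k)
  lemma₂ = solve-∀ ring

-- Dividing out z 0 leaves a quotient of smaller degree that still vanishes at all later z i. An
-- infinite supply of zeros spares matching their number to the degree bound.
infinitely-many-zeros⇒0 : ∀ {d a h} → Lead d a h → (z : ℕ → ℚ) → (∀ {i j} → z i ≡ z j → i ≡ j) →
  (∀ i → h (z i) ≡ 0ℚ) → a ≡ 0ℚ × (∀ t → h t ≡ 0ℚ)
infinitely-many-zeros⇒0 (const eq) z inj hz =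
  trans (sym (eq (z 0))) (hz 0) , λ t → trans (eq t) (trans (sym (eq (z 0))) (hz 0))
infinitely-many-zeros⇒0 {suc d} {h = h} l z inj hz = proj₁ ih , λ t → trans (h≗ t)
  (trans (cong₂ _+_ (hz 0) (trans (cong ((t - z 0) *_) (proj₂ ih t)) (*-zeroʳ (t - z 0)))) (+-identityʳ 0ℚ))
  where
  k = proj₁ (factor (z 0) l)
  h≗ : ∀ t → h t ≡ h (z 0) + (t - z 0) * k t
  h≗ = proj₂ (proj₂ (factor (z 0) l))
  kz : ∀ i → k (z (suc i)) ≡ 0ℚ
  kz i = p*q≡0⇒q≡0 (z (suc i) - z 0) (k (z (suc i)))
    (λ eq → contradiction (inj (p-q≡0⇒p≡q (z (suc i)) (z 0) eq)) λ ())
    (trans (sym (+-identityˡ ((z (suc i) - z 0) * k (z (suc i)))))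
    (trans (cong (_+ (z (suc i) - z 0) * k (z (suc i))) (sym (hz 0)))
    (trans (sym (h≗ (z (suc i)))) (hz (suc i)))))
  ih = infinitely-many-zeros⇒0 (proj₁ (proj₂ (factor (z 0) l))) (λ i → z (suc i))
    (λ eq → ℕ.suc-injective (inj eq)) kz

-- Lead₂ d c T: T (x , y) is a polynomial function of total degree at most d
-- in which x ^ d has coefficient c, presented in Horner form in y.
data Lead₂ : ℕ → ℚ → (ℚ → ℚ → ℚ) → Set where
  base : ∀ {d c C T} → Lead d c C → (∀ x y → T x y ≡ C x) → Lead₂ d c T
  step : ∀ {d c c′ C T T′} → Lead (suc d) c C → Lead₂ d c′ T′ →
         (∀ x y → T x y ≡ C x + y * T′ x y) → Lead₂ (suc d) c T

Lead₂-resp : ∀ {d c c′ T T′} → c′ ≡ c → (∀ x y → T′ x y ≡ T x y) → Lead₂ d c T → Lead₂ d c′ T′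
Lead₂-resp refl T′≗T (base l eq)    = base l λ x y → trans (T′≗T x y) (eq x y)
Lead₂-resp refl T′≗T (step l m eq)  = step l m λ x y → trans (T′≗T x y) (eq x y)

Lead₂-+ : ∀ {d a c C T} → Lead d a C → Lead₂ d c T → Lead₂ d (a + c) (λ x y → C x + T x y)
Lead₂-+ {C = C} l (base l′ eq)   = base (Lead-+ l l′) λ x y → cong (C x +_) (eq x y)
Lead₂-+ {C = C} l (step l′ m eq) = step (Lead-+ l l′) m λ x y →
  trans (cong (C x +_) (eq x y)) (sym (+-assoc (C x) _ _))

-- Two uses: the form x - y builds polynomials in x - y by Horner's rule, and one further linear
-- form then yields `W`. The part β y cannot touch the pure power of x.
Lead₂-linear : ∀ {d c T} α β → Lead₂ d c T → Lead₂ (suc d) (α * c) (λ x y → (α * x + β * y) * T x y)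
Lead₂-linear α β (base {C = C} l eq) =
  step (Lead-var (Lead-scale α l)) (base (Lead-scale β l) λ x y → refl) λ x y →
  trans (cong ((α * x + β * y) *_) (eq x y)) (lemma α β x y (C x))
  where
  lemma : ∀ α β x y c → (α * x + β * y) * c ≡ x * (α * c) + y * (β * c)
  lemma = solve-∀ ring
Lead₂-linear α β (step {C = C} {T′ = T′} l m eq) =
  step (Lead-var (Lead-scale α l)) (Lead₂-+ (Lead-scale β l) (Lead₂-linear α β m)) λ x y →
  trans (cong ((α * x + β * y) *_) (eq x y)) (lemma α β x y (C x) (T′ x y))
  where
  lemma : ∀ α β x y c t → (α * x + β * y) * (c + y * t) ≡ x * (α * c) + y * (β * c + (α * x + β * y) * t)
  lemma = solve-∀ ring

Lead₂-x-y : ∀ {d a h} → Lead d a h → Lead₂ d a (λ x y → h (x - y))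
Lead₂-x-y (const eq) = base (Lead-const _) λ x y → eq (x - y)
Lead₂-x-y {suc d} {a} (horner {g = g} b l eq) = Lead₂-resp (lemma₀ a)
  (λ x y → trans (eq (x - y)) (lemma b x y (g (x - y))))
  (Lead₂-+ (Lead-< (s≤s z≤n) (Lead-const b)) (Lead₂-linear 1ℚ (- 1ℚ) (Lead₂-x-y l)))
  where
  lemma₀ : ∀ a → a ≡ 0ℚ + 1ℚ * a
  lemma₀ = solve-∀ ring
  lemma : ∀ b x y t → b + (x - y) * t ≡ b + (1ℚ * x + (- 1ℚ) * y) * t
  lemma = solve-∀ ring

private
  -- Each Horner layer C(x) y ^ i is summed over y alone, C(x) being constant there; the exponent i
  -- records the factors y already taken out. For fixed y the degree in x does not grow, but on the
  -- diagonal the antidifference of y ^ i adds its own degree.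
  antidifference₂ : ∀ {d c T} → Lead₂ d c T → ∀ i → Σ[ V ∈ (ℚ → ℚ → ℚ) ]
    (∀ x y → V x y - V x (y + 1ℚ) ≡ pow i y * T x y) ×
    (∀ y → ∃[ a ] Lead d a (λ x → V x y)) ×
    ∃[ b ] Lead (d ℕ.+ suc i) b (λ x → V x x)
  antidifference₂ (base {C = C} l eq) i =
    let S , telescope , _ , lS = antidifference i (Lead-pow i) in
    (λ x y → S y * C x) ,
    (λ x y → trans (lemma (S y) (S (y + 1ℚ)) (C x)) (cong₂ _*_ (telescope y) (sym (eq x y)))) ,
    (λ y → _ , Lead-scale (S y) l) ,
    _ , Lead-resp refl refl (λ x → *-comm (S x) (C x)) (Lead-* l lS)
    where
    lemma : ∀ p q c → p * c - q * c ≡ (p - q) * c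
    lemma = solve-∀ ring
  antidifference₂ {suc d} (step {C = C} {T′ = T′} l m eq) i =
    let S , telescope , _ , lS = antidifference i (Lead-pow i)
        V , telescope′ , lV , _ , lV′ = antidifference₂ m (suc i) in
    (λ x y → S y * C x + V x y) ,
    (λ x y → trans (lemma (S y) (S (y + 1ℚ)) (C x) (V x y) (V x (y + 1ℚ)))
      (trans (cong₂ (λ p q → p * C x + q) (telescope y) (telescope′ x y))
      (trans (lemma′ (pow i y) y (C x) (T′ x y)) (cong (pow i y *_) (sym (eq x y)))))) ,
    (λ y → _ , Lead-+ (Lead-scale (S y) l) (Lead-raise (proj₂ (lV y)))) ,
    _ , Lead-+ (Lead-resp refl refl (λ x → *-comm (S x) (C x)) (Lead-* l lS))
               (Lead-resp (sym (ℕ.+-suc d (suc i))) refl (λ _ → refl) lV′)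
    where
    lemma : ∀ p q c v w → (p * c + v) - (q * c + w) ≡ (p - q) * c + (v - w)
    lemma = solve-∀ ring
    lemma′ : ∀ p y c t → p * c + y * p * t ≡ p * (c + y * t)
    lemma′ = solve-∀ ring

bump : ℚ → ℚ
bump y = ½ * (y * (1ℚ - y))

-- For fixed y, only the x ^ d y term of y T (x , y) reaches degree d in x, and
-- bump is the antidifference of y that vanishes at 0.
summation : ∀ {d c T} → Lead₂ d c T → Σ[ V ∈ (ℚ → ℚ → ℚ) ]
  (∀ x y → V x y - V x (y + 1ℚ) ≡ y * T x y) ×
  (∀ y → Lead d (bump y * c) (λ x → V x y)) ×
  ∃[ b ] Lead (d ℕ.+ 2) b (λ x → V x x)
summation {d} {c} {T} m =
  let C , V , l , telescope , lV , _ , lV′ = first m in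
  (λ x y → bump y * C x + V x y) ,
  (λ x y → trans (lemma₁ (bump y) (bump (y + 1ℚ)) (C x) (V x y) (V x (y + 1ℚ)))
    (trans (cong₂ (λ p q → p * C x + q) (bump-telescope y) (telescope x y)) (lemma₂ y (C x) (T x y)))) ,
  (λ y → Lead-resp refl (sym (+-identityʳ (bump y * c))) (λ x → refl) (Lead-+ (Lead-scale (bump y) l) (lV y))) ,
  _ , Lead-+ (Lead-resp refl refl (λ x → *-comm (bump x) (C x)) (Lead-* l Lead-bump)) lV′
  where
  first : ∀ {d c T} → Lead₂ d c T → Σ[ C ∈ (ℚ → ℚ) ] Σ[ V ∈ (ℚ → ℚ → ℚ) ] Lead d c C ×
    (∀ x y → V x y - V x (y + 1ℚ) ≡ y * (T x y - C x)) ×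
    (∀ y → Lead d 0ℚ (λ x → V x y)) × ∃[ b ] Lead (d ℕ.+ 2) b (λ x → V x x)
  first {d} (base {C = C} l eq) = C , (λ _ _ → 0ℚ) , l ,
    (λ x y → trans (lemma y (C x)) (cong (λ v → y * (v - C x)) (sym (eq x y)))) ,
    (λ y → Lead-0 d) , 0ℚ , Lead-0 (d ℕ.+ 2)
    where
    lemma : ∀ y c → 0ℚ - 0ℚ ≡ y * (c - c)
    lemma = solve-∀ ring
  first {suc d} (step {C = C} {T′ = T′} l m eq) =
    -- Here C(x) = T(x , 0), so y (T - C) = y ^ 2 T′, whence the exponent 2. As T′ has one degree
    -- less, this part misses the top power of x for every fixed y.
    let V , telescope , lV , _ , lV′ = antidifference₂ m 2 in
    C , V , l ,
    (λ x y → trans (telescope x y) (trans (lemma y (C x) (T′ x y)) (cong (λ v → y * (v - C x)) (sym (eq x y))))) ,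
    (λ y → Lead-raise (proj₂ (lV y))) , _ , Lead-resp (sym (ℕ.+-suc d 2)) refl (λ _ → refl) lV′
    where
    lemma : ∀ y c t → (y * (y * 1ℚ)) * t ≡ y * ((c + y * t) - c)
    lemma = solve-∀ ring
  lemma₁ : ∀ p q c v w → (p * c + v) - (q * c + w) ≡ (p - q) * c + (v - w)
  lemma₁ = solve-∀ ring
  lemma₂ : ∀ y c t → y * c + y * (t - c) ≡ y * t
  lemma₂ = solve-∀ ring
  bump-telescope : ∀ y → bump y - bump (y + 1ℚ) ≡ y
  bump-telescope y = trans (lemma ½ y) (*-identityˡ y)
    where
    lemma : ∀ h y → h * (y * (1ℚ - y)) - h * ((y + 1ℚ) * (1ℚ - (y + 1ℚ))) ≡ (h + h) * y
    lemma = solve-∀ ring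
  Lead-bump : Lead 2 (- ½) bump
  Lead-bump = horner 0ℚ (horner ½ (const λ _ → refl) λ t → refl) λ t → lemma ½ t
    where
    lemma : ∀ h y → h * (y * (1ℚ - y)) ≡ 0ℚ + y * (h + y * (- h))
    lemma = solve-∀ ring

-- Newton's identities

-- For p j = Σ_C |C| ^ (j + 1) over the classes C of an equivalence relation,
-- elementary p q counts the q-sets S of pairwise inequivalent elements, and
-- weighted p q j sums |C| ^ (j + 1) over such S and the classes C not meeting S.
elementary : (ℕ → ℚ) → ℕ → ℚ
weighted : (ℕ → ℚ) → ℕ → ℕ → ℚ
elementary p zero    = 1ℚ
elementary p (suc q) = recip q * weighted p q 0
weighted p zero    j = p j
weighted p (suc q) j = elementary p (suc q) * p j - weighted p q (suc j)

elementary-cong : ∀ {p p′} → (∀ j → p j ≡ p′ j) → ∀ q → elementary p q ≡ elementary p′ q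
weighted-cong : ∀ {p p′} → (∀ j → p j ≡ p′ j) → ∀ q j → weighted p q j ≡ weighted p′ q j
elementary-cong eq zero    = refl
elementary-cong eq (suc q) = cong (recip q *_) (weighted-cong eq q 0)
weighted-cong eq zero    j = eq j
weighted-cong eq (suc q) j = cong₂ _-_ (cong₂ _*_ (elementary-cong eq (suc q)) (eq j)) (weighted-cong eq q (suc j))

-- Leading terms through Newton's recursion

module Growth (p : ℚ → ℕ → ℚ) (κ : ℚ) (p0 : ∀ x → p x 0 ≡ κ * (x * x))
  (lp : ∀ j → ∃[ b ] Lead (suc (suc j)) b (λ x → p x j)) where

  -- This is κ ^ q / q!. With κ = M ^ 2 and x = n / M it expresses that to leading order all q-sets
  -- of the n ^ 2 points count.
  leading : ℕ → ℚ
  leading zero    = 1ℚ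
  leading (suc q) = recip q * (leading q * κ)

  0<leading : 0ℚ < κ → ∀ q → 0ℚ < leading q
  0<leading 0<κ zero    = 0<1
  0<leading 0<κ (suc q) = 0<p*q (0<recip q) (0<p*q (0<leading 0<κ q) 0<κ)

  Lead-p0 : Lead 2 κ (λ x → p x 0)
  Lead-p0 = horner 0ℚ (horner 0ℚ (const λ _ → refl) λ _ → refl) λ x → trans (p0 x) (lemma κ x)
    where
    lemma : ∀ k x → k * (x * x) ≡ 0ℚ + x * (0ℚ + x * k)
    lemma = solve-∀ ring

  Lead-elementary  : ∀ q → Lead (q ℕ.* 2) (leading q) (λ x → elementary (p x) q)
  Lead-weighted  : ∀ q j → ∃[ b ] Lead (q ℕ.* 2 ℕ.+ suc (suc j)) b (λ x → weighted (p x) q j)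
  Lead-weighted-0 : ∀ q → Lead (q ℕ.* 2 ℕ.+ 2) (leading q * κ) (λ x → weighted (p x) q 0)

  Lead-elementary zero    = Lead-const 1ℚ
  Lead-elementary (suc q) = Lead-resp (ℕ.+-comm 2 (q ℕ.* 2)) refl (λ _ → refl) (Lead-scale (recip q) (Lead-weighted-0 q))

  Lead-weighted zero    j = lp j
  Lead-weighted (suc q) j = _ , Lead-- (Lead-* (Lead-elementary (suc q)) (proj₂ (lp j)))
    (Lead-resp (cong suc (sym (ℕ.+-suc (q ℕ.* 2) (suc (suc j))))) refl (λ _ → refl)
      (Lead-raise (proj₂ (Lead-weighted q (suc j)))))

  Lead-weighted-0 zero    = Lead-resp refl (*-identityˡ κ) (λ _ → refl) Lead-p0
  -- The subtracted `weighted` term has degree 2 q + 3, one below the product with p_0, and so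
  -- leaves the leading coefficient alone.
  Lead-weighted-0 (suc q) = Lead-resp refl (lemma (leading (suc q) * κ)) (λ _ → refl)
    (Lead-- (Lead-* (Lead-elementary (suc q)) Lead-p0)
      (Lead-resp (cong suc (sym (ℕ.+-suc (q ℕ.* 2) 2))) refl (λ _ → refl)
        (Lead-raise (proj₂ (Lead-weighted q 1)))))
    where
    lemma : ∀ x → x ≡ x - 0ℚ
    lemma = solve-∀ ring

module Comparison (p p′ : ℚ → ℕ → ℚ) (κ : ℚ) (0<κ : 0ℚ < κ)
  (p0 : ∀ x → p x 0 ≡ κ * (x * x)) (p′0 : ∀ x → p′ x 0 ≡ κ * (x * x))
  (lp : ∀ j → ∃[ b ] Lead (suc (suc j)) b (λ x → p x j))
  (lp′ : ∀ j → ∃[ b ] Lead (suc (suc j)) b (λ x → p′ x j))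
  (β : ℕ → ℚ) (0<β : 0ℚ < β 1)
  (lδ : ∀ j → Lead j (β j) (λ x → p x j - p′ x j)) where

  open Growth p κ p0 lp
  module G′ = Growth p′ κ p′0 lp′

  δelementary : ℕ → ℚ → ℚ
  δelementary q x = elementary (p x) q - elementary (p′ x) q

  δweighted : ℕ → ℕ → ℚ → ℚ
  δweighted q j x = weighted (p x) q j - weighted (p′ x) q j

  leibniz : ∀ q j x → δweighted (suc q) j x ≡
    (δelementary (suc q) x * p x j + elementary (p′ x) (suc q) * (p x j - p′ x j)) - δweighted q (suc j) x
  leibniz q j x = lemma (elementary (p x) (suc q)) (elementary (p′ x) (suc q)) (p x j) (p′ x j)
                        (weighted (p x) q (suc j)) (weighted (p′ x) q (suc j))
    where
    lemma : ∀ e e′ s s′ a a′ → (e * s - a) - (e′ * s′ - a′) ≡ ((e - e′) * s + e′ * (s - s′)) - (a - a′)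
    lemma = solve-∀ ring

  leibniz-0 : ∀ q x → δweighted (suc q) 0 x ≡ δelementary (suc q) x * p x 0 - δweighted q 1 x
  leibniz-0 q x = trans (leibniz q 0 x)
    (cong (_- δweighted q 1 x) (trans (cong (λ v → δelementary (suc q) x * p x 0 + elementary (p′ x) (suc q) * v)
      (trans (cong (_- p′ x 0) (trans (p0 x) (sym (p′0 x)))) (+-inverseʳ (p′ x 0))))
      (lemma (δelementary (suc q) x * p x 0) (elementary (p′ x) (suc q)))))
    where
    lemma : ∀ a b → a + b * 0ℚ ≡ a
    lemma = solve-∀ ring

  δelementary-suc : ∀ q x → δelementary (suc q) x ≡ recip q * δweighted q 0 x
  δelementary-suc q x = lemma (recip q) (weighted (p x) q 0) (weighted (p′ x) q 0)
    where
    lemma : ∀ r a b → r * a - r * b ≡ r * (a - b)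
    lemma = solve-∀ ring

  δelementary-1 : ∀ x → δelementary 1 x ≡ 0ℚ
  δelementary-1 x = trans (δelementary-suc 0 x) (trans (cong (recip 0 *_)
    (trans (cong (_- p′ x 0) (trans (p0 x) (sym (p′0 x)))) (+-inverseʳ (p′ x 0)))) (*-zeroʳ (recip 0)))

  -- In `leibniz` the first and the last term fall short of the degree of the middle one, so only
  -- the change of p_j shows in the leading coefficient. The index 1 is a case of its own because
  -- `Lead-δelementary` starts at 2, the difference at 1 being zero.
  Lead-δweighted : ∀ q j → Lead (q ℕ.* 2 ℕ.+ j) (leading q * β j) (δweighted q j)
  -- Recording the coefficient as - γ with γ positive makes the induction work: the previous
  -- difference times p_0 and the subtracted change of `weighted` at j = 1 both contribute
  -- negatively, so they cannot cancel.
  Lead-δelementary : ∀ q → ∃[ γ ] (0ℚ < γ × Lead (suc (q ℕ.* 2)) (- γ) (δelementary (suc (suc q))))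

  Lead-δweighted zero j = Lead-resp refl (*-identityˡ (β j)) (λ _ → refl) (lδ j)
  Lead-δweighted (suc zero) j = Lead-resp refl (lemma (leading 1 * β j))
    (λ x → trans (leibniz 0 j x) (cong (_- δweighted 0 (suc j) x)
      (trans (cong (λ v → v * p x j + elementary (p′ x) 1 * (p x j - p′ x j)) (δelementary-1 x))
             (lemma′ (p x j) (elementary (p′ x) 1 * (p x j - p′ x j))))))
    (Lead-- (Lead-* (G′.Lead-elementary 1) (lδ j)) (Lead-raise (lδ (suc j))))
    where
    lemma : ∀ a → a ≡ a - 0ℚ
    lemma = solve-∀ ring
    lemma′ : ∀ a b → 0ℚ * a + b ≡ b
    lemma′ = solve-∀ ring
  Lead-δweighted (suc (suc q)) j = Lead-resp refl (lemma (leading (suc (suc q)) * β j)) (leibniz (suc q) j)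
    (Lead-- (Lead-+ (Lead-resp degree refl (λ _ → refl) (Lead-raise (Lead-* (proj₂ (proj₂ (Lead-δelementary q))) (proj₂ (lp j)))))
                    (Lead-* (G′.Lead-elementary (suc (suc q))) (lδ j)))
            (Lead-resp (cong (λ k → suc (suc (suc k))) (sym (ℕ.+-suc (q ℕ.* 2) j))) refl (λ _ → refl)
              (Lead-raise (Lead-δweighted (suc q) (suc j)))))
    where
    lemma : ∀ a → a ≡ (0ℚ + a) - 0ℚ
    lemma = solve-∀ ring
    degree : suc (suc (suc (suc (q ℕ.* 2)))) ℕ.+ j ≡ suc (suc (q ℕ.* 2) ℕ.+ suc (suc j))
    degree = cong (λ k → suc (suc k)) (sym (trans (ℕ.+-suc (q ℕ.* 2) (suc j)) (cong suc (ℕ.+-suc (q ℕ.* 2) j))))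

  Lead-δelementary zero = recip 1 * β 1 , 0<p*q (0<recip 1) 0<β ,
    Lead-resp refl (lemma (recip 1) (β 1))
      (λ x → trans (δelementary-suc 1 x) (cong (recip 1 *_) (trans (leibniz-0 0 x)
        (trans (cong (λ v → v * p x 0 - δweighted 0 1 x) (δelementary-1 x)) (lemma′ (p x 0) (δweighted 0 1 x))))))
      (Lead-scale (recip 1) (Lead-scale (- 1ℚ) (lδ 1)))
    where
    lemma : ∀ r b → - (r * b) ≡ r * ((- 1ℚ) * b)
    lemma = solve-∀ ring
    lemma′ : ∀ s a → 0ℚ * s - a ≡ (- 1ℚ) * a
    lemma′ = solve-∀ ring
  Lead-δelementary (suc q) = let γ , 0<γ , l = Lead-δelementary q in
    recip (suc (suc q)) * (γ * κ + leading (suc q) * β 1) ,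
    0<p*q (0<recip (suc (suc q))) (0<p+q (0<p*q 0<γ 0<κ) (0<p*q (0<leading 0<κ (suc q)) 0<β)) ,
    Lead-resp refl (lemma (recip (suc (suc q))) γ κ (leading (suc q) * β 1))
      (λ x → trans (δelementary-suc (suc (suc q)) x) (cong (recip (suc (suc q)) *_) (leibniz-0 (suc q) x)))
      (Lead-scale (recip (suc (suc q)))
        (Lead-- (Lead-resp (ℕ.+-comm 2 (suc (q ℕ.* 2))) refl (λ _ → refl) (Lead-* l Lead-p0))
                (Lead-resp (ℕ.+-comm 1 (suc q ℕ.* 2)) refl (λ _ → refl) (Lead-δweighted (suc q) 1))))
    where
    lemma : ∀ r γ κ b → - (r * (γ * κ + b)) ≡ r * ((- γ) * κ - b)
    lemma = solve-∀ ring

-- Power sums as polynomials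

sumTo : ℕ → (ℕ → ℚ) → ℚ
sumTo zero    f = 0ℚ
sumTo (suc n) f = sumTo n f + f (suc n)

sumTo-cong : ∀ {f g} n → (∀ k → 1 ℕ.≤ k → k ℕ.≤ n → f k ≡ g k) → sumTo n f ≡ sumTo n g
sumTo-cong zero    eq = refl
sumTo-cong (suc n) eq = cong₂ _+_ (sumTo-cong n λ k 1≤k k≤n → eq k 1≤k (ℕ.m≤n⇒m≤1+n k≤n)) (eq (suc n) (s≤s z≤n) ℕ.≤-refl)

sumTo-0 : ∀ n → sumTo n (λ _ → 0ℚ) ≡ 0ℚ
sumTo-0 zero    = refl
sumTo-0 (suc n) = trans (+-identityʳ (sumTo n λ _ → 0ℚ)) (sumTo-0 n)

sumTo-truncate : ∀ {f m n} → m ℕ.≤ n → (∀ k → m ℕ.< k → f k ≡ 0ℚ) → sumTo n f ≡ sumTo m f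
sumTo-truncate {f} {m} m≤n f≡0 = go (ℕ.≤⇒≤′ m≤n)
  where
  go : ∀ {n} → m ℕ.≤′ n → sumTo n f ≡ sumTo m f
  go ℕ.≤′-refl = refl
  go {suc n} (ℕ.≤′-step m≤n) = trans (cong₂ _+_ (go m≤n) (f≡0 (suc n) (s≤s (ℕ.≤′⇒≤ m≤n)))) (+-identityʳ (sumTo m f))

-- A point with s later points on its line accounts for `Δpow j s` in the power sum. Since
-- `Δpow j 0` is 1, this is 1 plus the values of `Δ²pow j` at 1 to s, which are the weights w_j.
Δpow Δ²pow : ℕ → ℚ → ℚ
Δpow j t = pow (suc j) (t + 1ℚ) - pow (suc j) t
Δ²pow j t = Δpow j t - Δpow j (t - 1ℚ)

Lead-Δ²pow : ∀ i → Lead i (fromℕ (suc i) * (fromℕ (suc (suc i)) * 1ℚ)) (Δ²pow (suc i))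
Lead-Δ²pow i = Lead-resp refl refl
  (λ t → cong (λ v → Δpow (suc i) v - Δpow (suc i) (t - 1ℚ)) (lemma t))
  (Lead-shift (- 1ℚ) (Lead-difference (Lead-difference (Lead-pow (suc (suc i))))))
  where
  lemma : ∀ t → t ≡ t - 1ℚ + 1ℚ
  lemma = solve-∀ ring

Δ²pow-0 : ∀ t → Δ²pow 0 t ≡ 0ℚ
Δ²pow-0 = lemma
  where
  lemma : ∀ t → ((t + 1ℚ) * 1ℚ - t * 1ℚ) - ((t - 1ℚ + 1ℚ) * 1ℚ - (t - 1ℚ) * 1ℚ) ≡ 0ℚ
  lemma = solve-∀ ring

module PowerSums (M a : ℚ) where

  α : ℚ
  α = M * (M - a)

  -- With n = M x and k = x - y, the two side factors are n - k a = (M - a) x + a y and n - k M = M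
  -- y. `W` is their product with the weight for j = i + 1, after one factor y has been taken out;
  -- `summation` puts it back.
  W : ℕ → ℚ → ℚ → ℚ
  W i x y = (α * x + M * a * y) * Δ²pow (suc i) (x - y)

  c : ℕ → ℚ
  c i = α * (fromℕ (suc i) * (fromℕ (suc (suc i)) * 1ℚ))

  Lead₂-W : ∀ i → Lead₂ (suc i) (c i) (W i)
  Lead₂-W i = Lead₂-linear α (M * a) (Lead₂-x-y (Lead-Δ²pow i))

  V : ℕ → ℚ → ℚ → ℚ
  V i = proj₁ (summation (Lead₂-W i))

  V-step : ∀ i x y → V i x y - V i x (y + 1ℚ) ≡ y * W i x y
  V-step i = proj₁ (proj₂ (summation (Lead₂-W i)))

  Lead-V : ∀ i y → Lead (suc i) (bump y * c i) (λ x → V i x y)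
  Lead-V i = proj₁ (proj₂ (proj₂ (summation (Lead₂-W i))))

  Lead-V-diagonal : ∀ i → ∃[ b ] Lead (suc i ℕ.+ 2) b (λ x → V i x x)
  Lead-V-diagonal i = proj₂ (proj₂ (proj₂ (summation (Lead₂-W i))))

  telescope : ∀ i x n → V i x (x - fromℕ n) - V i x x ≡
    sumTo n (λ k → (x - fromℕ k) * W i x (x - fromℕ k))
  telescope i x zero = trans (cong (λ v → V i x v - V i x x) (lemma x)) (+-inverseʳ (V i x x))
    where
    lemma : ∀ x → x - 0ℚ ≡ x
    lemma = solve-∀ ring
  telescope i x (suc n) = begin
    V i x y - V i x x
      ≡⟨ lemma (V i x y) (V i x (y + 1ℚ)) (V i x x) ⟩
    (V i x (y + 1ℚ) - V i x x) + (V i x y - V i x (y + 1ℚ))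
      ≡⟨ cong₂ _+_ (cong (λ v → V i x v - V i x x)
           (trans (cong (λ v → x - v + 1ℚ) (fromℕ-suc n)) (lemma′ x (fromℕ n)))) (V-step i x y) ⟩
    (V i x (x - fromℕ n) - V i x x) + y * W i x y
      ≡⟨ cong (_+ y * W i x y) (telescope i x n) ⟩
    sumTo n (λ k → (x - fromℕ k) * W i x (x - fromℕ k)) + y * W i x y ∎
    where
    open ≡-Reasoning
    y = x - fromℕ (suc n)
    lemma : ∀ p q r → p - r ≡ (q - r) + (p - q)
    lemma = solve-∀ ring
    lemma′ : ∀ x k → x - (1ℚ + k) + 1ℚ ≡ x - k
    lemma′ = solve-∀ ring

  -- ρ stands for r / M. Keeping it separate from x makes this a polynomial in x for each residue
  -- class; it is the power sum of the board when x = n / M and x - ρ is the integer part of x.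
  powerSum : ℚ → ℚ → ℕ → ℚ
  powerSum ρ x zero    = M * M * (x * x)
  powerSum ρ x (suc i) = M * M * (x * x) + (V i x ρ - V i x x)

  powerSum-formula : ∀ j x n → powerSum (x - fromℕ n) x j ≡ M * M * (x * x) +
    sumTo n (λ k → Δ²pow j (fromℕ k) * ((M * x - a * fromℕ k) * (M * x - M * fromℕ k)))
  powerSum-formula zero x n = sym (trans (cong (M * M * (x * x) +_)
    (trans (sumTo-cong n λ k _ _ → trans (cong (_* N k) (Δ²pow-0 (fromℕ k))) (*-zeroˡ (N k))) (sumTo-0 n)))
    (+-identityʳ (M * M * (x * x))))
    where
    N : ℕ → ℚ
    N k = (M * x - a * fromℕ k) * (M * x - M * fromℕ k)
  powerSum-formula (suc i) x n = cong (M * M * (x * x) +_) (trans (telescope i x n)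
    (sumTo-cong n λ k _ _ → trans
      (cong (λ v → (x - fromℕ k) * ((α * x + M * a * (x - fromℕ k)) * Δ²pow (suc i) v)) (lemma x (fromℕ k)))
      (lemma′ M a x (fromℕ k) (Δ²pow (suc i) (fromℕ k)))))
    where
    lemma : ∀ x k → x - (x - k) ≡ k
    lemma = solve-∀ ring
    lemma′ : ∀ M a x k d → (x - k) * ((M * (M - a) * x + M * a * (x - k)) * d) ≡
                            d * ((M * x - a * k) * (M * x - M * k))
    lemma′ = solve-∀ ring

  Lead-square : Lead 2 (M * M) (λ x → M * M * (x * x))
  Lead-square = horner 0ℚ (horner 0ℚ (const λ _ → refl) λ _ → refl) (lemma (M * M))
    where
    lemma : ∀ k x → k * (x * x) ≡ 0ℚ + x * (0ℚ + x * k)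
    lemma = solve-∀ ring

  Lead-powerSum : ∀ ρ j → ∃[ b ] Lead (suc (suc j)) b (λ x → powerSum ρ x j)
  Lead-powerSum ρ zero    = _ , Lead-square
  Lead-powerSum ρ (suc i) = _ , Lead-+ (Lead-< (s≤s (s≤s (s≤s z≤n))) Lead-square)
    (Lead-- (Lead-raise (Lead-raise (Lead-V i ρ)))
            (Lead-resp (ℕ.+-comm 2 (suc i)) refl (λ _ → refl) (proj₂ (Lead-V-diagonal i))))

  -- For ρ = r / M the value at 1 is r (M - r) (M - a) / M.
  β : ℚ → ℕ → ℚ
  β ρ zero    = 0ℚ
  β ρ (suc i) = bump ρ * c i - bump 0ℚ * c i

  Lead-powerSum-difference : ∀ ρ j → Lead j (β ρ j) (λ x → powerSum ρ x j - powerSum 0ℚ x j)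
  Lead-powerSum-difference ρ zero    = const λ x → +-inverseʳ (M * M * (x * x))
  Lead-powerSum-difference ρ (suc i) = Lead-resp refl refl
    (λ x → lemma (M * M * (x * x)) (V i x ρ) (V i x 0ℚ) (V i x x))
    (Lead-- (Lead-V i ρ) (Lead-V i 0ℚ))
    where
    lemma : ∀ s p q r → (s + (p - r)) - (s + (q - r)) ≡ p - q
    lemma = solve-∀ ring

  0<β1 : 0ℚ < M → 0ℚ < M - a → ∀ {ρ} → 0ℚ < ρ → 0ℚ < 1ℚ - ρ → 0ℚ < β ρ 1
  0<β1 0<M 0<M-a {ρ} 0<ρ 0<1-ρ = subst (0ℚ <_) (lemma ½ ρ (c 0))
    (0<p*q (0<p*q (positive⁻¹ ½) (0<p*q 0<ρ 0<1-ρ))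
           (0<p*q (0<p*q 0<M 0<M-a) (0<p*q (0<fromℕ-suc 0) (0<p*q (0<fromℕ-suc 1) 0<1))))
    where
    lemma : ∀ h ρ c → h * (ρ * (1ℚ - ρ)) * c ≡ h * (ρ * (1ℚ - ρ)) * c - h * (0ℚ * (1ℚ - 0ℚ)) * c
    lemma = solve-∀ ring

  Lead-elementary-powerSum : ∀ ρ q → ∃[ b ] Lead (q ℕ.* 2) b (λ x → elementary (powerSum ρ x) q)
  Lead-elementary-powerSum ρ q = _ , Growth.Lead-elementary (powerSum ρ) (M * M) (λ _ → refl) (Lead-powerSum ρ) q

  elementary-difference : 0ℚ < M → 0ℚ < M - a → ∀ {ρ} → 0ℚ < ρ → 0ℚ < 1ℚ - ρ → ∀ q →
    ∃[ γ ] (0ℚ < γ × Lead (suc (q ℕ.* 2)) (- γ)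
      (λ x → elementary (powerSum ρ x) (suc (suc q)) - elementary (powerSum 0ℚ x) (suc (suc q))))
  elementary-difference 0<M 0<M-a {ρ} 0<ρ 0<1-ρ = Comparison.Lead-δelementary (powerSum ρ) (powerSum 0ℚ) (M * M) (0<p*q 0<M 0<M)
    (λ _ → refl) (λ _ → refl) (Lead-powerSum ρ) (Lead-powerSum 0ℚ) (β ρ)
    (0<β1 0<M 0<M-a 0<ρ 0<1-ρ) (Lead-powerSum-difference ρ)

-- The period

toℕ-mod : ∀ n p .{{_ : ℕ.NonZero p}} → toℕ (n mod p) ≡ n % p
toℕ-mod n p = toℕ-fromℕ< (m%n<n n p)

-- The strict bound on `a` is asked for only if M > 1: a diagonal move has a = M = 1. For larger M
-- it keeps the factor M - a, and with it the difference between the constituents, from vanishing.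
module Period (a m : ℕ) (a≤1+m : a ℕ.≤ suc m) (a<1+m : 1 ℕ.≤ m → a ℕ.< suc m) (q : ℕ) (f : ℕ → ℚ)
  (f-formula : ∀ n → f n ≡ elementary (λ j → fromℕ n * fromℕ n + sumTo n λ k →
    Δ²pow j (fromℕ k) * (fromℕ (n ℕ.∸ k ℕ.* a) * fromℕ (n ℕ.∸ k ℕ.* suc m))) (suc (suc q))) where

  M : ℕ
  M = suc m

  open PowerSums (fromℕ M) (fromℕ a)

  R : ℚ
  R = recip m

  F : ℕ → ℚ → ℚ
  F r x = elementary (powerSum (fromℕ r * R) x) (suc (suc q))

  M*[t*R]≡t : ∀ t → fromℕ M * (t * R) ≡ t
  M*[t*R]≡t t = trans (lemma (fromℕ M) t R) (trans (cong (t *_) (recip-inverse m)) (*-identityʳ t))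
    where
    lemma : ∀ M t r → M * (t * r) ≡ t * (M * r)
    lemma = solve-∀ ring

  f≡F : ∀ n r k → n ≡ r ℕ.+ k ℕ.* M → r ℕ.< M → f n ≡ F r (fromℕ n * R)
  f≡F n r l n≡ r<M = trans (f-formula n) (elementary-cong power (suc (suc q)))
    where
    x = fromℕ n * R
    x-l≡ρ : x - fromℕ l ≡ fromℕ r * R
    x-l≡ρ = begin
      fromℕ n * R - fromℕ l                              ≡⟨ cong (λ v → fromℕ v * R - fromℕ l) n≡ ⟩
      fromℕ (r ℕ.+ l ℕ.* M) * R - fromℕ l                ≡⟨ cong (λ v → v * R - fromℕ l) (trans (fromℕ-+ r (l ℕ.* M)) (cong (fromℕ r +_) (fromℕ-* l M))) ⟩
      (fromℕ r + fromℕ l * fromℕ M) * R - fromℕ l        ≡⟨ lemma (fromℕ r) (fromℕ l) (fromℕ M) R ⟩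
      fromℕ r * R + fromℕ l * (fromℕ M * R) - fromℕ l    ≡⟨ cong (λ v → fromℕ r * R + fromℕ l * v - fromℕ l) (recip-inverse m) ⟩
      fromℕ r * R + fromℕ l * 1ℚ - fromℕ l               ≡⟨ lemma′ (fromℕ r * R) (fromℕ l) ⟩
      fromℕ r * R ∎
      where
      open ≡-Reasoning
      lemma : ∀ r l M R → (r + l * M) * R - l ≡ r * R + l * (M * R) - l
      lemma = solve-∀ ring
      lemma′ : ∀ r l → r + l * 1ℚ - l ≡ r
      lemma′ = solve-∀ ring
    lM≤n : l ℕ.* M ℕ.≤ n
    lM≤n = ℕ.≤-trans (ℕ.m≤n+m (l ℕ.* M) r) (ℕ.≤-reflexive (sym n≡))
    l≤n : l ℕ.≤ n
    l≤n = ℕ.≤-trans (ℕ.m≤m*n l M) lM≤n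
    -- For k > l truncated subtraction makes n ∸ k M zero. For k ≤ l no truncation takes place, so
    -- the sum up to l has polynomial terms.
    n≤kM : ∀ k → l ℕ.< k → n ℕ.≤ k ℕ.* M
    n≤kM k l<k = ℕ.≤-trans (ℕ.≤-reflexive n≡) (ℕ.≤-trans (ℕ.+-monoˡ-≤ (l ℕ.* M) (ℕ.<⇒≤ r<M)) (ℕ.*-monoˡ-≤ M l<k))
    term : ℕ → ℕ → ℚ
    term j k = Δ²pow j (fromℕ k) * (fromℕ (n ℕ.∸ k ℕ.* a) * fromℕ (n ℕ.∸ k ℕ.* M))
    factor-eq : ∀ b k → k ℕ.* b ℕ.≤ n → fromℕ (n ℕ.∸ k ℕ.* b) ≡ fromℕ M * x - fromℕ b * fromℕ k
    factor-eq b k kb≤n = trans (fromℕ-∸ kb≤n) (cong₂ _-_ (sym (M*[t*R]≡t (fromℕ n)))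
      (trans (fromℕ-* k b) (*-comm (fromℕ k) (fromℕ b))))
    power : ∀ j → fromℕ n * fromℕ n + sumTo n (term j) ≡ powerSum (fromℕ r * R) x j
    power j = begin
      fromℕ n * fromℕ n + sumTo n (term j)
        ≡⟨ cong (fromℕ n * fromℕ n +_) (sumTo-truncate l≤n λ k l<k →
             trans (cong (λ v → Δ²pow j (fromℕ k) * (fromℕ (n ℕ.∸ k ℕ.* a) * fromℕ v)) (ℕ.m≤n⇒m∸n≡0 (n≤kM k l<k)))
                   (lemma₀ (Δ²pow j (fromℕ k)) (fromℕ (n ℕ.∸ k ℕ.* a)))) ⟩
      fromℕ n * fromℕ n + sumTo l (term j)
        ≡⟨ cong₂ _+_
             (trans (sym (cong₂ _*_ (M*[t*R]≡t (fromℕ n)) (M*[t*R]≡t (fromℕ n)))) (lemma₁ (fromℕ M) x))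
             (sumTo-cong l λ k _ k≤l →
               let kM≤n = ℕ.≤-trans (ℕ.*-monoˡ-≤ M k≤l) lM≤n in
               cong (Δ²pow j (fromℕ k) *_) (cong₂ _*_
                 (factor-eq a k (ℕ.≤-trans (ℕ.*-monoʳ-≤ k a≤1+m) kM≤n)) (factor-eq M k kM≤n))) ⟩
      fromℕ M * fromℕ M * (x * x) + sumTo l (λ k → Δ²pow j (fromℕ k) *
        ((fromℕ M * x - fromℕ a * fromℕ k) * (fromℕ M * x - fromℕ M * fromℕ k)))
        ≡⟨ powerSum-formula j x l ⟨
      powerSum (x - fromℕ l) x j
        ≡⟨ cong (λ ρ → powerSum ρ x j) x-l≡ρ ⟩
      powerSum (fromℕ r * R) x j ∎
      where
      open ≡-Reasoning
      lemma₀ : ∀ d s → d * (s * 0ℚ) ≡ 0ℚ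
      lemma₀ = solve-∀ ring
      lemma₁ : ∀ M x → (M * x) * (M * x) ≡ M * M * (x * x)
      lemma₁ = solve-∀ ring

  Lead-F : ∀ r → ∃[ b ] Lead (suc (suc q) ℕ.* 2) b (F r)
  Lead-F r = Lead-elementary-powerSum (fromℕ r * R) (suc (suc q))

  constituent : ∀ r → Σ[ h ∈ Polynomial ] ∀ t → eval h t ≡ F r (R * t)
  constituent r = coefficients (proj₂ (Lead-dilate R (proj₂ (Lead-F r))))

  quasipolynomial : IsQuasipolynomialMod f M
  quasipolynomial = _ , (λ i → proj₁ (constituent (toℕ i))) , λ n _ → begin
    f n                                   ≡⟨ f≡F n (n % M) (n / M) (m≡m%n+[m/n]*n n M) (m%n<n n M) ⟩
    F (n % M) (fromℕ n * R)               ≡⟨ cong (F (n % M)) (*-comm (fromℕ n) R) ⟩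
    F (n % M) (R * fromℕ n)               ≡⟨ cong (λ r → F r (R * fromℕ n)) (toℕ-mod n M) ⟨
    F (toℕ (n mod M)) (R * fromℕ n)       ≡⟨ proj₂ (constituent (toℕ (n mod M))) (fromℕ n) ⟨
    eval (proj₁ (constituent (toℕ (n mod M)))) (fromℕ n) ∎
    where open ≡-Reasoning

  -- The ratio p / M lies strictly between 0 and 1, where `bump` is positive; this gives the
  -- difference of the two constituents a nonzero leading coefficient.
  F-distinct : ∀ p → 1 ℕ.≤ p → p ℕ.< M → (∀ x → F p x ≡ F 0 x) → ⊥
  F-distinct p 1≤p p<M Fp≡F0 =
    let γ , 0<γ , l = elementary-difference (0<fromℕ-suc m) 0<M-a 0<ρ 0<1-ρ q in
    <-irrefl (sym (neΔpow-0 γ (proj₁ (infinitely-many-zeros⇒0 l fromℕ fromℕ-injective zeros)))) 0<γ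
    where
    0<difference : ∀ {k n} → k ℕ.< n → 0ℚ < fromℕ n - fromℕ k
    0<difference {k} {n} k<n = subst (0ℚ <_) (fromℕ-∸ (ℕ.<⇒≤ k<n))
      (subst (λ v → 0ℚ < fromℕ v) (ℕ.suc-pred (n ℕ.∸ k) {{ℕ.>-nonZero (ℕ.m<n⇒0<n∸m k<n)}}) (0<fromℕ-suc (ℕ.pred (n ℕ.∸ k))))
    0<M-a : 0ℚ < fromℕ M - fromℕ a
    0<M-a = 0<difference (a<1+m (ℕ.≤-trans 1≤p (ℕ.s≤s⁻¹ p<M)))
    0<ρ : 0ℚ < fromℕ p * R
    0<ρ = 0<p*q (subst (0ℚ <_) (lemma (fromℕ p)) (0<difference 1≤p)) (0<recip m)
      where
      lemma : ∀ t → t - 0ℚ ≡ t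
      lemma = solve-∀ ring
    0<1-ρ : 0ℚ < 1ℚ - fromℕ p * R
    0<1-ρ = subst (0ℚ <_) (trans (lemma (fromℕ M) (fromℕ p) R) (cong (_- fromℕ p * R) (recip-inverse m)))
      (0<p*q (0<difference p<M) (0<recip m))
      where
      lemma : ∀ M p r → (M - p) * r ≡ M * r - p * r
      lemma = solve-∀ ring
    neΔpow-0 : ∀ γ → - γ ≡ 0ℚ → γ ≡ 0ℚ
    neΔpow-0 γ eq = trans (lemma γ) (cong -_ eq)
      where
      lemma : ∀ γ → γ ≡ - (- γ)
      lemma = solve-∀ ring
    zeros : ∀ i → elementary (powerSum (fromℕ p * R) (fromℕ i)) (suc (suc q)) - elementary (powerSum 0ℚ (fromℕ i)) (suc (suc q)) ≡ 0ℚ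
    zeros i = trans (cong₂ _-_ (Fp≡F0 (fromℕ i)) (cong (λ ρ → elementary (powerSum ρ (fromℕ i)) (suc (suc q))) (sym (*-zeroˡ R))))
                    (+-inverseʳ (F 0 (fromℕ i)))

  -- The residue class 0 modulo p contains both M p (i + 1) and M p (i + 1) + p,
  -- which lie in the classes 0 and p modulo M.
  minimal : ∀ p → IsQuasipolynomialMod f p → M ℕ.≤ p
  minimal p (p≢0 , fs , f≡fs) = ℕ.≮⇒≥ λ p<M → F-distinct p 1≤p p<M λ x →
    trans (F≡h p p<M (λ i → m*n%n≡0 (suc (suc i ℕ.* M)) p) x)
          (sym (F≡h 0 (s≤s z≤n) (λ i → m*n%n≡0 (suc i ℕ.* M) p) x))
    where
    instance
      p-nonZero : ℕ.NonZero p
      p-nonZero = p≢0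
    1≤p : 1 ℕ.≤ p
    1≤p = ℕ.>-nonZero⁻¹ p
    h : ℚ → ℚ
    -- The constituents `fs` take n as argument, whereas `F` takes n / M.
    h x = eval (fs (0 mod p)) (fromℕ M * x)
    n : ℕ → ℕ → ℕ
    n r i = r ℕ.+ suc i ℕ.* M ℕ.* p
    F≡h : ∀ r → r ℕ.< M → (∀ i → n r i % p ≡ 0) → ∀ x → F r x ≡ h x
    F≡h r r<M n%p x = p-q≡0⇒p≡q (F r x) (h x) (proj₂ (infinitely-many-zeros⇒0
      (Lead-- (Lead-< (s≤s (ℕ.m≤m+n d d′)) (proj₂ (Lead-F r))) (Lead-< (s≤s (ℕ.m≤n+m d′ d)) (proj₂ l′)))
      z z-injective zeros) x)
      where
      d = suc (suc q) ℕ.* 2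
      d′ = proj₁ (Lead-eval (fs (0 mod p)))
      l′ : ∃[ b ] Lead d′ b h
      l′ = Lead-dilate (fromℕ M) (proj₂ (proj₂ (Lead-eval (fs (0 mod p)))))
      z : ℕ → ℚ
      z i = fromℕ (n r i) * R
      z-injective : ∀ {i j} → z i ≡ z j → i ≡ j
      z-injective {i} {j} eq = ℕ.suc-injective (ℕ.*-cancelʳ-≡ (suc i) (suc j) M
        (ℕ.*-cancelʳ-≡ (suc i ℕ.* M) (suc j ℕ.* M) p (ℕ.+-cancelˡ-≡ r _ _ (fromℕ-injective
          (trans (sym (M*[t*R]≡t (fromℕ (n r i)))) (trans (cong (fromℕ M *_) eq) (M*[t*R]≡t (fromℕ (n r j)))))))))
      zeros : ∀ i → F r (z i) - h (z i) ≡ 0ℚ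
      zeros i = trans (cong₂ _-_
        (trans (sym (f≡F (n r i) r (suc i ℕ.* p) (cong (r ℕ.+_) swap) r<M))
               (f≡fs (n r i) (ℕ.≤-trans 1≤n (ℕ.m≤n+m (suc i ℕ.* M ℕ.* p) r))))
        (cong₂ (λ k t → eval (fs k) t) (sym class) (M*[t*R]≡t (fromℕ (n r i)))))
        (+-inverseʳ (eval (fs (n r i mod p)) (fromℕ (n r i))))
        where
        swap : suc i ℕ.* M ℕ.* p ≡ suc i ℕ.* p ℕ.* M
        swap = trans (ℕ.*-assoc (suc i) M p) (trans (cong (suc i ℕ.*_) (ℕ.*-comm M p)) (sym (ℕ.*-assoc (suc i) p M)))
        1≤n : 1 ℕ.≤ suc i ℕ.* M ℕ.* p
        1≤n = ℕ.*-mono-≤ {1} {suc i ℕ.* M} {1} {p} (s≤s z≤n) 1≤p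
        class : n r i mod p ≡ 0 mod p
        class = toℕ-injective (trans (toℕ-mod (n r i) p) (trans (n%p i) (sym (trans (toℕ-mod 0 p) (m*n%n≡0 0 p)))))

  hasPeriod : HasPeriod f M
  hasPeriod = quasipolynomial , minimal

-- Counting by equivalence classes

∑ : ∀ {A : Set} → List A → (A → ℚ) → ℚ
∑ []       f = 0ℚ
∑ (x ∷ xs) f = f x + ∑ xs f

∑-cong : ∀ {A : Set} {f g : A → ℚ} xs → (∀ x → f x ≡ g x) → ∑ xs f ≡ ∑ xs g
∑-cong []       eq = refl
∑-cong (x ∷ xs) eq = cong₂ _+_ (eq x) (∑-cong xs eq)

∑-cong-All : ∀ {A : Set} {f g : A → ℚ} {xs} → All (λ x → f x ≡ g x) xs → ∑ xs f ≡ ∑ xs g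
∑-cong-All []         = refl
∑-cong-All (eq ∷ eqs) = cong₂ _+_ eq (∑-cong-All eqs)

∑-+ : ∀ {A : Set} (f g : A → ℚ) xs → ∑ xs (λ x → f x + g x) ≡ ∑ xs f + ∑ xs g
∑-+ f g []       = refl
∑-+ f g (x ∷ xs) = trans (cong (f x + g x +_) (∑-+ f g xs)) (lemma (f x) (g x) (∑ xs f) (∑ xs g))
  where
  lemma : ∀ a b c d → (a + b) + (c + d) ≡ (a + c) + (b + d)
  lemma = solve-∀ ring

∑-*ˡ : ∀ {A : Set} s (f : A → ℚ) xs → ∑ xs (λ x → s * f x) ≡ s * ∑ xs f
∑-*ˡ s f []       = sym (*-zeroʳ s)
∑-*ˡ s f (x ∷ xs) = trans (cong (s * f x +_) (∑-*ˡ s f xs)) (sym (*-distribˡ-+ s (f x) (∑ xs f)))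

∑-0 : ∀ {A : Set} {f : A → ℚ} {xs} → All (λ x → f x ≡ 0ℚ) xs → ∑ xs f ≡ 0ℚ
∑-0 []         = refl
∑-0 {f = f} {x ∷ xs} (eq ∷ eqs) = trans (cong (_+ ∑ xs f) eq) (trans (+-identityˡ (∑ xs f)) (∑-0 eqs))

𝟙 : ∀ {P : Set} → Dec P → ℚ
𝟙 (yes _) = 1ℚ
𝟙 (no  _) = 0ℚ

𝟙-yes : ∀ {P : Set} (d : Dec P) → P → 𝟙 d ≡ 1ℚ
𝟙-yes (yes _) p = refl
𝟙-yes (no ¬p) p = contradiction p ¬p

𝟙-no : ∀ {P : Set} (d : Dec P) → ¬ P → 𝟙 d ≡ 0ℚ
𝟙-no (yes p) ¬p = contradiction p ¬p
𝟙-no (no _)  ¬p = refl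

𝟙-⇔ : ∀ {P Q : Set} (d : Dec P) (e : Dec Q) → (P → Q) → (Q → P) → 𝟙 d ≡ 𝟙 e
𝟙-⇔ (yes p) e f g = sym (𝟙-yes e (f p))
𝟙-⇔ (no ¬p) e f g = sym (𝟙-no e λ q → ¬p (g q))

module Classes {A : Set} (_∼_ : A → A → Set) (_∼?_ : ∀ x y → Dec (x ∼ y))
  (∼-refl : ∀ {x} → x ∼ x) (∼-sym : ∀ {x y} → x ∼ y → y ∼ x) (∼-trans : ∀ {x y z} → x ∼ y → y ∼ z → x ∼ z) where

  class : A → List A → ℚ
  class x X = ∑ X λ y → 𝟙 (x ∼? y)

  without : A → List A → List A
  without x = filter λ y → ¬? (x ∼? y)

  -- The number of ways to pick q pairwise inequivalent entries, that is, the elementary symmetric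
  -- polynomial of the class sizes. Picking the first entry rules out its whole class.
  e : ℕ → List A → ℚ
  e zero    X       = 1ℚ
  e (suc q) []      = 0ℚ
  e (suc q) (x ∷ X) = e (suc q) X + e q (without x X)

  without-∼ : ∀ {x y} X → x ∼ y → without x (y ∷ X) ≡ without x X
  without-∼ {x} X x∼y = filter-reject (λ y → ¬? (x ∼? y)) λ x≁y → x≁y x∼y

  without-≁ : ∀ {x y} X → ¬ x ∼ y → without x (y ∷ X) ≡ y ∷ without x X
  without-≁ {x} X x≁y = filter-accept (λ y → ¬? (x ∼? y)) x≁y

  without-cong : ∀ {x y} → x ∼ y → ∀ X → without x X ≡ without y X
  without-cong {x} {y} x∼y = filter-≐ (λ z → ¬? (x ∼? z)) (λ z → ¬? (y ∼? z))
    ((λ x≁z y∼z → x≁z (∼-trans x∼y y∼z)) , (λ y≁z x∼z → y≁z (∼-trans (∼-sym x∼y) x∼z)))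

  without-comm : ∀ x y X → without x (without y X) ≡ without y (without x X)
  without-comm x y []      = refl
  without-comm x y (z ∷ X) = go (x ∼? z) (y ∼? z)
    where
    ih = without-comm x y X
    go : Dec (x ∼ z) → Dec (y ∼ z) → without x (without y (z ∷ X)) ≡ without y (without x (z ∷ X))
    go (yes x∼z) (yes y∼z) = trans (cong (without x) (without-∼ X y∼z))
      (trans ih (sym (cong (without y) (without-∼ X x∼z))))
    go (yes x∼z) (no y≁z) = trans (cong (without x) (without-≁ X y≁z)) (trans (without-∼ (without y X) x∼z)
      (trans ih (sym (cong (without y) (without-∼ X x∼z)))))
    go (no x≁z) (yes y∼z) = trans (cong (without x) (without-∼ X y∼z))
      (trans ih (sym (trans (cong (without y) (without-≁ X x≁z)) (without-∼ (without x X) y∼z))))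
    go (no x≁z) (no y≁z) = trans (cong (without x) (without-≁ X y≁z)) (trans (without-≁ (without y X) x≁z)
      (trans (cong (z ∷_) ih) (sym (trans (cong (without y) (without-≁ X x≁z)) (without-≁ (without x X) y≁z)))))

  class-without : ∀ {x y} → ¬ x ∼ y → ∀ X → class x (without y X) ≡ class x X
  class-without x≁y []      = refl
  class-without {x} {y} x≁y (z ∷ X) = go (y ∼? z)
    where
    ih = class-without x≁y X
    go : Dec (y ∼ z) → class x (without y (z ∷ X)) ≡ class x (z ∷ X)
    go (yes y∼z) = trans (cong (class x) (without-∼ X y∼z)) (trans ih (sym (trans
      (cong (_+ class x X) (𝟙-no (x ∼? z) λ x∼z → x≁y (∼-trans x∼z (∼-sym y∼z)))) (+-identityˡ (class x X)))))
    go (no y≁z) = trans (cong (class x) (without-≁ X y≁z)) (cong (𝟙 (x ∼? z) +_) ih)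

  class-cong : ∀ {x y} → x ∼ y → ∀ X → class x X ≡ class y X
  class-cong {x} {y} x∼y X = ∑-cong X λ z → 𝟙-⇔ (x ∼? z) (y ∼? z) (∼-trans (∼-sym x∼y)) (∼-trans x∼y)

  -- A selection meets the class of x at most once: either it avoids the class, or one of the
  -- `class x X` members is joined to a selection that avoids it.
  e-split : ∀ q x X → e (suc q) X ≡ e (suc q) (without x X) + class x X * e q (without x X)
  e-split q x [] = sym (trans (+-identityˡ (0ℚ * e q [])) (*-zeroˡ (e q [])))
  e-split q x (y ∷ Y) = go q (x ∼? y)
    where
    Yx = without x Y
    k = class x Y
    go : ∀ q → Dec (x ∼ y) → e (suc q) (y ∷ Y) ≡
      e (suc q) (without x (y ∷ Y)) + class x (y ∷ Y) * e q (without x (y ∷ Y))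
    go q (yes x∼y) = begin
      e (suc q) Y + e q (without y Y)
        ≡⟨ cong₂ _+_ (e-split q x Y) (cong (e q) (sym (without-cong x∼y Y))) ⟩
      e (suc q) Yx + k * e q Yx + e q Yx
        ≡⟨ lemma (e (suc q) Yx) k (e q Yx) ⟩
      e (suc q) Yx + (1ℚ + k) * e q Yx
        ≡⟨ cong₂ (λ i Z → e (suc q) Z + (i + k) * e q Z) (𝟙-yes (x ∼? y) x∼y) (without-∼ Y x∼y) ⟨
      e (suc q) (without x (y ∷ Y)) + class x (y ∷ Y) * e q (without x (y ∷ Y)) ∎
      where
      open ≡-Reasoning
      lemma : ∀ a k b → a + k * b + b ≡ a + (1ℚ + k) * b
      lemma = solve-∀ ring
    -- The inner e q of a nonempty list unfolds only for positive q, hence the separate case.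
    go zero (no x≁y) = begin
      e 1 Y + 1ℚ
        ≡⟨ cong (_+ 1ℚ) (e-split 0 x Y) ⟩
      e 1 Yx + k * 1ℚ + 1ℚ
        ≡⟨ lemma (e 1 Yx) k ⟩
      e 1 Yx + 1ℚ + (0ℚ + k) * 1ℚ
        ≡⟨ cong₂ (λ i Z → e 1 Z + (i + k) * 1ℚ) (𝟙-no (x ∼? y) x≁y) (without-≁ Y x≁y) ⟨
      e 1 (without x (y ∷ Y)) + class x (y ∷ Y) * 1ℚ ∎
      where
      open ≡-Reasoning
      lemma : ∀ a k → a + k * 1ℚ + 1ℚ ≡ a + 1ℚ + (0ℚ + k) * 1ℚ
      lemma = solve-∀ ring
    go (suc q) (no x≁y) = begin
      e (suc (suc q)) Y + e (suc q) (without y Y)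
        ≡⟨ cong₂ _+_ (e-split (suc q) x Y) (trans (e-split q x (without y Y))
             (cong₂ (λ i Z → e (suc q) Z + i * e q Z) (class-without x≁y Y) (without-comm x y Y))) ⟩
      e (suc (suc q)) Yx + k * e (suc q) Yx + (e (suc q) (without y Yx) + k * e q (without y Yx))
        ≡⟨ lemma (e (suc (suc q)) Yx) k (e (suc q) Yx) (e (suc q) (without y Yx)) (e q (without y Yx)) ⟩
      e (suc (suc q)) (y ∷ Yx) + (0ℚ + k) * e (suc q) (y ∷ Yx)
        ≡⟨ cong₂ (λ i Z → e (suc (suc q)) Z + (i + k) * e (suc q) Z) (𝟙-no (x ∼? y) x≁y) (without-≁ Y x≁y) ⟨
      e (suc (suc q)) (without x (y ∷ Y)) + class x (y ∷ Y) * e (suc q) (without x (y ∷ Y)) ∎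
      where
      open ≡-Reasoning
      lemma : ∀ a k b c d → a + k * b + (c + k * d) ≡ (a + c) + (0ℚ + k) * (b + d)
      lemma = solve-∀ ring

  ∑-without : ∀ (f : A → ℚ) y X → ∑ (without y X) f ≡ ∑ X (λ x → 𝟙 (¬? (y ∼? x)) * f x)
  ∑-without f y []      = refl
  ∑-without f y (x ∷ X) = go (y ∼? x)
    where
    go : Dec (y ∼ x) → ∑ (without y (x ∷ X)) f ≡ 𝟙 (¬? (y ∼? x)) * f x + ∑ X (λ x → 𝟙 (¬? (y ∼? x)) * f x)
    go (yes y∼x) = trans (cong (λ Z → ∑ Z f) (without-∼ X y∼x)) (trans (∑-without f y X)
      (sym (trans (cong (λ i → i * f x + ∑ X (λ x → 𝟙 (¬? (y ∼? x)) * f x)) (𝟙-no (¬? (y ∼? x)) λ y≁x → y≁x y∼x))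
                  (lemma (f x) (∑ X (λ x → 𝟙 (¬? (y ∼? x)) * f x))))))
      where
      lemma : ∀ a b → 0ℚ * a + b ≡ b
      lemma = solve-∀ ring
    go (no y≁x) = trans (cong (λ Z → ∑ Z f) (without-≁ X y≁x)) (cong₂ _+_
      (sym (trans (cong (_* f x) (𝟙-yes (¬? (y ∼? x)) y≁x)) (*-identityˡ (f x)))) (∑-without f y X))

  -- Double counting of the pairs formed by a selection and a distinguished member x: the other
  -- members form a selection outside the class of x.
  e-remove : ∀ q X → fromℕ (suc q) * e (suc q) X ≡ ∑ X (λ x → e q (without x X))
  e-remove q [] = *-zeroʳ (fromℕ (suc q))
  e-remove q (y ∷ Y) = begin
    fromℕ (suc q) * (e (suc q) Y + e q (without y Y))
      ≡⟨ *-distribˡ-+ (fromℕ (suc q)) (e (suc q) Y) (e q (without y Y)) ⟩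
    fromℕ (suc q) * e (suc q) Y + fromℕ (suc q) * e q (without y Y)
      ≡⟨ cong₂ _+_ (e-remove q Y) (cong (_* e q (without y Y)) (fromℕ-suc q)) ⟩
    ∑ Y (λ x → e q (without x Y)) + (1ℚ + fromℕ q) * e q (without y Y)
      ≡⟨ lemma (∑ Y (λ x → e q (without x Y))) (fromℕ q) (e q (without y Y)) ⟩
    e q (without y Y) + (∑ Y (λ x → e q (without x Y)) + fromℕ q * e q (without y Y))
      ≡⟨ cong₂ _+_ (cong (e q) (without-∼ Y ∼-refl)) (tail q) ⟨
    e q (without y (y ∷ Y)) + ∑ Y (λ x → e q (without x (y ∷ Y))) ∎
    where
    open ≡-Reasoning
    lemma : ∀ a n b → a + (1ℚ + n) * b ≡ b + (a + n * b)
    lemma = solve-∀ ring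
    tail : ∀ q → ∑ Y (λ x → e q (without x (y ∷ Y))) ≡ ∑ Y (λ x → e q (without x Y)) + fromℕ q * e q (without y Y)
    tail zero    = sym (trans (cong (∑ Y (λ _ → 1ℚ) +_) (*-zeroˡ 1ℚ)) (+-identityʳ (∑ Y (λ _ → 1ℚ))))
    -- Outside the class of x, a selection either avoids y or, if x and y are inequivalent, consists
    -- of y and entries outside both classes.
    tail (suc q) = begin
      ∑ Y (λ x → e (suc q) (without x (y ∷ Y)))
        ≡⟨ ∑-cong Y (λ x → go x (y ∼? x)) ⟩
      ∑ Y (λ x → e (suc q) (without x Y) + 𝟙 (¬? (y ∼? x)) * e q (without x (without y Y)))
        ≡⟨ ∑-+ (λ x → e (suc q) (without x Y)) (λ x → 𝟙 (¬? (y ∼? x)) * e q (without x (without y Y))) Y ⟩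
      ∑ Y (λ x → e (suc q) (without x Y)) + ∑ Y (λ x → 𝟙 (¬? (y ∼? x)) * e q (without x (without y Y)))
        ≡⟨ cong (∑ Y (λ x → e (suc q) (without x Y)) +_) (trans (e-remove q (without y Y))
             (∑-without (λ x → e q (without x (without y Y))) y Y)) ⟨
      ∑ Y (λ x → e (suc q) (without x Y)) + fromℕ (suc q) * e (suc q) (without y Y) ∎
      where
      go : ∀ x → Dec (y ∼ x) → e (suc q) (without x (y ∷ Y)) ≡
        e (suc q) (without x Y) + 𝟙 (¬? (y ∼? x)) * e q (without x (without y Y))
      go x (yes y∼x) = trans (cong (e (suc q)) (without-∼ Y (∼-sym y∼x))) (sym (trans
        (cong (λ i → e (suc q) (without x Y) + i * e q (without x (without y Y)))
              (𝟙-no (¬? (y ∼? x)) λ y≁x → y≁x y∼x))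
        (lemma₀ (e (suc q) (without x Y)) (e q (without x (without y Y))))))
        where
        lemma₀ : ∀ a b → a + 0ℚ * b ≡ a
        lemma₀ = solve-∀ ring
      go x (no y≁x) = trans (cong (e (suc q)) (without-≁ Y λ x∼y → y≁x (∼-sym x∼y)))
        (cong (e (suc q) (without x Y) +_) (trans (cong (e q) (without-comm y x Y))
          (sym (trans (cong (_* e q (without x (without y Y))) (𝟙-yes (¬? (y ∼? x)) y≁x))
                      (*-identityˡ (e q (without x (without y Y))))))))

  powerSumOf : List A → ℕ → ℚ
  powerSumOf X j = ∑ X λ x → pow j (class x X)

  e≡elementary : ∀ q X → e q X ≡ elementary (powerSumOf X) q
  -- A sum over entries counts a class C once for each of its members, so `pow j` here amounts to
  -- the exponent j + 1 on classes. Solving `e-split` for the selections that avoid C turns the sum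
  -- into Newton's recursion.
  ∑-weighted : ∀ q j X → ∑ X (λ x → pow j (class x X) * e q (without x X)) ≡ weighted (powerSumOf X) q j

  e≡elementary zero    X = refl
  e≡elementary (suc q) X = begin
    e (suc q) X                                             ≡⟨ *-identityʳ (e (suc q) X) ⟨
    e (suc q) X * 1ℚ                                        ≡⟨ cong (e (suc q) X *_) (recip-inverse q) ⟨
    e (suc q) X * (fromℕ (suc q) * recip q)                 ≡⟨ lemma (e (suc q) X) (fromℕ (suc q)) (recip q) ⟩
    recip q * (fromℕ (suc q) * e (suc q) X)                 ≡⟨ cong (recip q *_) (e-remove q X) ⟩
    recip q * ∑ X (λ x → e q (without x X))                 ≡⟨ cong (recip q *_) (∑-cong X λ x → *-identityˡ (e q (without x X))) ⟨
    recip q * ∑ X (λ x → 1ℚ * e q (without x X))            ≡⟨ cong (recip q *_) (∑-weighted q 0 X) ⟩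
    recip q * weighted (powerSumOf X) q 0                          ∎
    where
    open ≡-Reasoning
    lemma : ∀ a n r → a * (n * r) ≡ r * (n * a)
    lemma = solve-∀ ring

  ∑-weighted zero    j X = ∑-cong X λ x → *-identityʳ (pow j (class x X))
  ∑-weighted (suc q) j X = begin
    ∑ X (λ x → pow j (class x X) * e (suc q) (without x X))
      ≡⟨ ∑-cong X (λ x → trans (lemma (pow j (class x X)) (e (suc q) (without x X)) (class x X) (e q (without x X)))
           (cong (λ v → v * pow j (class x X) + (- 1ℚ) * (pow (suc j) (class x X) * e q (without x X))) (sym (e-split q x X)))) ⟩
    ∑ X (λ x → e (suc q) X * pow j (class x X) + (- 1ℚ) * (pow (suc j) (class x X) * e q (without x X)))
      ≡⟨ ∑-+ (λ x → e (suc q) X * pow j (class x X)) (λ x → (- 1ℚ) * (pow (suc j) (class x X) * e q (without x X))) X ⟩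
    ∑ X (λ x → e (suc q) X * pow j (class x X)) + ∑ X (λ x → (- 1ℚ) * (pow (suc j) (class x X) * e q (without x X)))
      ≡⟨ cong₂ _+_ (∑-*ˡ (e (suc q) X) (λ x → pow j (class x X)) X)
                   (∑-*ˡ (- 1ℚ) (λ x → pow (suc j) (class x X) * e q (without x X)) X) ⟩
    e (suc q) X * powerSumOf X j + (- 1ℚ) * ∑ X (λ x → pow (suc j) (class x X) * e q (without x X))
      ≡⟨ cong₂ (λ a b → a * powerSumOf X j + (- 1ℚ) * b) (e≡elementary (suc q) X) (∑-weighted q (suc j) X) ⟩
    elementary (powerSumOf X) (suc q) * powerSumOf X j + (- 1ℚ) * weighted (powerSumOf X) q (suc j)
      ≡⟨ lemma′ (elementary (powerSumOf X) (suc q) * powerSumOf X j) (weighted (powerSumOf X) q (suc j)) ⟩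
    elementary (powerSumOf X) (suc q) * powerSumOf X j - weighted (powerSumOf X) q (suc j) ∎
    where
    open ≡-Reasoning
    lemma : ∀ p a k b → p * a ≡ (a + k * b) * p + (- 1ℚ) * ((k * p) * b)
    lemma = solve-∀ ring
    lemma′ : ∀ a b → a + (- 1ℚ) * b ≡ a - b
    lemma′ = solve-∀ ring

  -- A class of size k grows to k + 1, changing k ^ (j + 1) to (k + 1) ^ (j + 1). In the sum over
  -- entries this is the new term of x together with the increase of the k old terms.
  powerSumOf-∷ : ∀ j x Y → powerSumOf (x ∷ Y) j ≡ Δpow j (class x Y) + powerSumOf Y j
  powerSumOf-∷ j x Y = begin
    pow j (𝟙 (x ∼? x) + k) + ∑ Y (λ y → pow j (𝟙 (y ∼? x) + class y Y))
      ≡⟨ cong₂ _+_ (cong (λ i → pow j i) (trans (cong (_+ k) (𝟙-yes (x ∼? x) ∼-refl)) (+-comm 1ℚ k)))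
                   (∑-cong Y (λ y → go y (x ∼? y))) ⟩
    pow j (k + 1ℚ) + ∑ Y (λ y → pow j (class y Y) + d * 𝟙 (x ∼? y))
      ≡⟨ cong (pow j (k + 1ℚ) +_) (trans (∑-+ (λ y → pow j (class y Y)) (λ y → d * 𝟙 (x ∼? y)) Y)
           (cong (powerSumOf Y j +_) (∑-*ˡ d (λ y → 𝟙 (x ∼? y)) Y))) ⟩
    pow j (k + 1ℚ) + (powerSumOf Y j + d * k)
      ≡⟨ lemma (pow j (k + 1ℚ)) (pow j k) k (powerSumOf Y j) ⟩
    Δpow j k + powerSumOf Y j ∎
    where
    open ≡-Reasoning
    k = class x Y
    d = pow j (k + 1ℚ) - pow j k
    lemma : ∀ p p′ k s → p + (s + (p - p′) * k) ≡ ((k + 1ℚ) * p - k * p′) + s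
    lemma = solve-∀ ring
    go : ∀ y → Dec (x ∼ y) → pow j (𝟙 (y ∼? x) + class y Y) ≡ pow j (class y Y) + d * 𝟙 (x ∼? y)
    go y (yes x∼y) = trans
      (cong (λ i → pow j i) (trans (cong₂ _+_ (𝟙-yes (y ∼? x) (∼-sym x∼y)) (sym (class-cong x∼y Y))) (+-comm 1ℚ k)))
      (trans (lemma₁ (pow j (k + 1ℚ)) (pow j k))
        (sym (cong₂ (λ i v → pow j i + d * v) (sym (class-cong x∼y Y)) (𝟙-yes (x ∼? y) x∼y))))
      where
      lemma₁ : ∀ p p′ → p ≡ p′ + (p - p′) * 1ℚ
      lemma₁ = solve-∀ ring
    go y (no x≁y) = trans
      (cong (λ i → pow j i) (trans (cong (_+ class y Y) (𝟙-no (y ∼? x) λ y∼x → x≁y (∼-sym y∼x))) (+-identityˡ (class y Y))))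
      (sym (trans (cong (λ v → pow j (class y Y) + d * v) (𝟙-no (x ∼? y) x≁y)) (lemma₁ (pow j (class y Y)) d)))
      where
      lemma₁ : ∀ p d → p + d * 0ℚ ≡ p
      lemma₁ = solve-∀ ring

  -- If ρ x y indicates the equivalent pairs x, y in which y comes later in the
  -- list, power sums of class sizes are sums over positions within classes.
  powerSumOf-ordered : ∀ {S : A → A → Set} (ρ : A → A → ℚ) → (∀ x → ρ x x ≡ 0ℚ) →
    (∀ {x y} → S x y → 𝟙 (x ∼? y) ≡ ρ x y × ρ y x ≡ 0ℚ) →
    ∀ j {X} → AllPairs S X → powerSumOf X j ≡ ∑ X (λ x → Δpow j (∑ X (ρ x)))
  powerSumOf-ordered ρ irrefl later j [] = refl
  powerSumOf-ordered ρ irrefl later j {x ∷ Y} (Sx ∷ SY) = trans (powerSumOf-∷ j x Y) (cong₂ _+_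
    (cong (Δpow j) (trans (∑-cong-All (All.map (λ s → proj₁ (later s)) Sx))
      (sym (trans (cong (_+ ∑ Y (ρ x)) (irrefl x)) (+-identityˡ (∑ Y (ρ x)))))))
    (trans (powerSumOf-ordered ρ irrefl later j SY) (∑-cong-All (All.map
      (λ {y} s → cong (Δpow j) (sym (trans (cong (_+ ∑ Y (ρ y)) (proj₂ (later s))) (+-identityˡ (∑ Y (ρ y)))))) Sx))))

-- Sums over intervals

sumTo-const : ∀ n → sumTo n (λ _ → 1ℚ) ≡ fromℕ n
sumTo-const zero    = refl
sumTo-const (suc n) = trans (cong (_+ 1ℚ) (sumTo-const n)) (trans (+-comm (fromℕ n) 1ℚ) (sym (fromℕ-suc n)))

sumTo-zero : ∀ {f} n → (∀ k → 1 ℕ.≤ k → k ℕ.≤ n → f k ≡ 0ℚ) → sumTo n f ≡ 0ℚ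
sumTo-zero n f≡0 = trans (sumTo-cong n f≡0) (sumTo-0 n)

sumTo-front : ∀ f n → sumTo (suc n) f ≡ f 1 + sumTo n (λ k → f (suc k))
sumTo-front f zero    = +-comm 0ℚ (f 1)
sumTo-front f (suc n) = trans (cong (_+ f (suc (suc n))) (sumTo-front f n))
  (+-assoc (f 1) (sumTo n (λ k → f (suc k))) (f (suc (suc n))))

∑-sumTo : ∀ {A : Set} (f : A → ℕ → ℚ) n X → ∑ X (λ x → sumTo n (f x)) ≡ sumTo n (λ k → ∑ X (λ x → f x k))
∑-sumTo f zero    X = ∑-0 (All.universal (λ _ → refl) X)
∑-sumTo f (suc n) X = trans (∑-+ (λ x → sumTo n (f x)) (λ x → f x (suc n)) X)
  (cong (_+ ∑ X (λ x → f x (suc n))) (∑-sumTo f n X))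

sumTo-unique : ∀ {f} {k} n → 1 ℕ.≤ k → k ℕ.≤ n → f k ≡ 1ℚ → (∀ l → l ≢ k → f l ≡ 0ℚ) → sumTo n f ≡ 1ℚ
sumTo-unique zero 1≤k k≤0 _ _ = contradiction (ℕ.≤-trans 1≤k k≤0) λ ()
sumTo-unique {f} {k} (suc n) 1≤k k≤1+n fk≡1 f≡0 = go (ℕ.m≤n⇒m<n∨m≡n k≤1+n)
  where
  go : k ℕ.< suc n ⊎ k ≡ suc n → sumTo n f + f (suc n) ≡ 1ℚ
  go (inj₁ k<1+n) = trans (cong₂ _+_ (sumTo-unique n 1≤k (ℕ.s≤s⁻¹ k<1+n) fk≡1 f≡0)
    (f≡0 (suc n) λ 1+n≡k → ℕ.<⇒≢ k<1+n (sym 1+n≡k))) (+-identityʳ 1ℚ)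
  go (inj₂ refl) = trans (cong₂ _+_ (sumTo-zero n λ l _ l≤n → f≡0 l λ l≡k → ℕ.<⇒≢ (s≤s l≤n) l≡k) fk≡1) (+-identityˡ 1ℚ)

count-≤ : ∀ {f m n} → m ℕ.≤ n → (∀ k → 1 ℕ.≤ k → k ℕ.≤ m → f k ≡ 1ℚ) → (∀ k → m ℕ.< k → f k ≡ 0ℚ) → sumTo n f ≡ fromℕ m
count-≤ {m = m} m≤n f≡1 f≡0 = trans (sumTo-truncate m≤n f≡0) (trans (sumTo-cong m f≡1) (sumTo-const m))

count-> : ∀ {f m} n → (∀ k → 1 ℕ.≤ k → k ℕ.≤ m → f k ≡ 0ℚ) → (∀ k → m ℕ.< k → k ℕ.≤ n → f k ≡ 1ℚ) → sumTo n f ≡ fromℕ (n ℕ.∸ m)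
count-> {m = m} zero f≡0 f≡1 = cong fromℕ (sym (ℕ.0∸n≡0 m))
count-> {f} {m} (suc n) f≡0 f≡1 = go (ℕ.≤-<-connex (suc n) m)
  where
  go : suc n ℕ.≤ m ⊎ m ℕ.< suc n → sumTo (suc n) f ≡ fromℕ (suc n ℕ.∸ m)
  go (inj₁ 1+n≤m) = trans (sumTo-zero (suc n) λ k 1≤k k≤1+n → f≡0 k 1≤k (ℕ.≤-trans k≤1+n 1+n≤m))
    (cong fromℕ (sym (ℕ.m≤n⇒m∸n≡0 1+n≤m)))
  go (inj₂ m<1+n) = begin
    sumTo n f + f (suc n)
      ≡⟨ cong₂ _+_ (count-> n f≡0 λ k m<k k≤n → f≡1 k m<k (ℕ.m≤n⇒m≤1+n k≤n)) (f≡1 (suc n) m<1+n ℕ.≤-refl) ⟩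
    fromℕ (n ℕ.∸ m) + 1ℚ        ≡⟨ +-comm (fromℕ (n ℕ.∸ m)) 1ℚ ⟩
    1ℚ + fromℕ (n ℕ.∸ m)        ≡⟨ fromℕ-suc (n ℕ.∸ m) ⟨
    fromℕ (suc (n ℕ.∸ m))       ≡⟨ cong fromℕ (ℕ.+-∸-assoc 1 (ℕ.s≤s⁻¹ m<1+n)) ⟨
    fromℕ (suc n ℕ.∸ m)         ∎
    where open ≡-Reasoning

-- Summation by parts: by `down` the indices satisfying P form an initial segment, along which the
-- differences of `h` telescope.
sumTo-initial : ∀ {P : ℕ → Set} (P? : ∀ k → Dec (P k)) → (∀ k → P (suc (suc k)) → P (suc k)) → ∀ (h : ℚ → ℚ) n →
  h (sumTo n (λ k → 𝟙 (P? k))) ≡ h 0ℚ + sumTo n (λ k → 𝟙 (P? k) * (h (fromℕ k) - h (fromℕ k - 1ℚ)))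
sumTo-initial P? down h zero = sym (+-identityʳ (h 0ℚ))
sumTo-initial {P} P? down h (suc n) = go (P? (suc n))
  where
  f D : ℕ → ℚ
  f k = 𝟙 (P? k)
  D k = h (fromℕ k) - h (fromℕ k - 1ℚ)
  descend : ∀ n → P (suc n) → ∀ k → 1 ℕ.≤ k → k ℕ.≤ n → f k ≡ 1ℚ
  descend zero    _  (suc k) _   ()
  descend (suc n) pn k       1≤k k≤1+n = step′ (ℕ.m≤n⇒m<n∨m≡n k≤1+n)
    where
    step′ : k ℕ.< suc n ⊎ k ≡ suc n → f k ≡ 1ℚ
    step′ (inj₁ k<1+n) = descend n (down n pn) k 1≤k (ℕ.s≤s⁻¹ k<1+n)
    step′ (inj₂ refl)  = 𝟙-yes (P? (suc n)) (down n pn)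
  go : Dec (P (suc n)) → h (sumTo n f + f (suc n)) ≡ h 0ℚ + (sumTo n (λ k → f k * D k) + f (suc n) * D (suc n))
  go (no ¬p) = trans (cong h (trans (cong (sumTo n f +_) (𝟙-no (P? (suc n)) ¬p)) (+-identityʳ (sumTo n f))))
    (trans (sumTo-initial P? down h n) (cong (h 0ℚ +_) (sym
      (trans (cong (λ i → sumTo n (λ k → f k * D k) + i * D (suc n)) (𝟙-no (P? (suc n)) ¬p))
             (lemma (sumTo n (λ k → f k * D k)) (D (suc n)))))))
    where
    lemma : ∀ a b → a + 0ℚ * b ≡ a
    lemma = solve-∀ ring
  go (yes p) = begin
    h (sumTo n f + f (suc n))
      ≡⟨ cong h (trans (cong₂ _+_ all-ones (𝟙-yes (P? (suc n)) p)) (trans (+-comm (fromℕ n) 1ℚ) (sym (fromℕ-suc n)))) ⟩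
    h (fromℕ (suc n))
      ≡⟨ lemma (h (fromℕ (suc n))) (h (fromℕ n)) ⟩
    h (fromℕ n) + 1ℚ * (h (fromℕ (suc n)) - h (fromℕ n))
      ≡⟨ cong₂ (λ u v → h u + 1ℚ * (h (fromℕ (suc n)) - h v)) (sym all-ones)
           (trans (lemma′ (fromℕ n)) (cong (_- 1ℚ) (sym (fromℕ-suc n)))) ⟩
    h (sumTo n f) + 1ℚ * D (suc n)
      ≡⟨ cong₂ (λ u i → u + i * D (suc n)) (sumTo-initial P? down h n) (sym (𝟙-yes (P? (suc n)) p)) ⟩
    h 0ℚ + sumTo n (λ k → f k * D k) + f (suc n) * D (suc n)
      ≡⟨ +-assoc (h 0ℚ) (sumTo n (λ k → f k * D k)) (f (suc n) * D (suc n)) ⟩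
    h 0ℚ + (sumTo n (λ k → f k * D k) + f (suc n) * D (suc n)) ∎
    where
    open ≡-Reasoning
    all-ones : sumTo n f ≡ fromℕ n
    all-ones = trans (sumTo-cong n (descend n p)) (sumTo-const n)
    lemma : ∀ a b → a ≡ b + 1ℚ * (a - b)
    lemma = solve-∀ ring
    lemma′ : ∀ a → a ≡ (1ℚ + a) - 1ℚ
    lemma′ = solve-∀ ring

∑-map : ∀ {A B : Set} (h : A → B) f xs → ∑ (map h xs) f ≡ ∑ xs (λ x → f (h x))
∑-map h f []       = refl
∑-map h f (x ∷ xs) = cong (f (h x) +_) (∑-map h f xs)

∑-++ : ∀ {A : Set} (f : A → ℚ) xs ys → ∑ (xs ++ ys) f ≡ ∑ xs f + ∑ ys f
∑-++ f []       ys = sym (+-identityˡ (∑ ys f))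
∑-++ f (x ∷ xs) ys = trans (cong (f x +_) (∑-++ f xs ys)) (sym (+-assoc (f x) (∑ xs f) (∑ ys f)))

∑-product : ∀ {A B : Set} (f : A → ℚ) (h : B → ℚ) xs ys →
  ∑ (cartesianProduct xs ys) (λ z → f (proj₁ z) * h (proj₂ z)) ≡ ∑ xs f * ∑ ys h
∑-product f h []       ys = sym (*-zeroˡ (∑ ys h))
∑-product f h (x ∷ xs) ys = trans
  (∑-++ (λ z → f (proj₁ z) * h (proj₂ z)) (map (x ,_) ys) (cartesianProduct xs ys))
  (trans (cong₂ _+_ (trans (∑-map (x ,_) (λ z → f (proj₁ z) * h (proj₂ z)) ys) (∑-*ˡ (f x) h ys)) (∑-product f h xs ys))
         (sym (*-distribʳ-+ (∑ ys h) (f x) (∑ xs f))))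

∑-range : ∀ n f → ∑ (range n) f ≡ sumTo n (λ k → f (pos k))
∑-range n f = trans (∑-map (λ i → pos (suc i)) f (upTo n)) (go n (λ i → i) λ _ → refl)
  where
  go : ∀ n (φ : ℕ → ℕ) {h : ℕ → ℚ} → (∀ i → f (pos (suc (φ i))) ≡ h (suc i)) →
    ∑ (applyUpTo φ n) (λ i → f (pos (suc i))) ≡ sumTo n h
  go zero    φ eq = refl
  go (suc n) φ {h} eq = trans (cong₂ _+_ (eq 0) (go n (λ i → φ (suc i)) λ i → eq (suc i))) (sym (sumTo-front h n))

InRange : ℕ → ℤ → Set
InRange n a = 1ℤ ℤ.≤ a × a ℤ.≤ pos n

inRange? : ∀ n a → Dec (InRange n a)
inRange? n a = 1ℤ ℤ.≤? a ×-dec a ℤ.≤? pos n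

pos-inRange : ∀ {n k} → 1 ℕ.≤ k → k ℕ.≤ n → InRange n (pos k)
pos-inRange 1≤k k≤n = ℤ.+≤+ 1≤k , ℤ.+≤+ k≤n

∑-range-≟ : ∀ n b → ∑ (range n) (λ a → 𝟙 (a ℤ.≟ b)) ≡ 𝟙 (inRange? n b)
∑-range-≟ n b = trans (∑-range n (λ a → 𝟙 (a ℤ.≟ b))) (go b (inRange? n b))
  where
  go : ∀ b (d : Dec (InRange n b)) → sumTo n (λ k → 𝟙 (pos k ℤ.≟ b)) ≡ 𝟙 d
  go (pos k) (yes (ℤ.+≤+ 1≤k , ℤ.+≤+ k≤n)) = sumTo-unique n 1≤k k≤n (𝟙-yes (pos k ℤ.≟ pos k) refl)
    λ l l≢k → 𝟙-no (pos l ℤ.≟ pos k) λ eq → l≢k (ℤ.+-injective eq)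
  go b (no b∉) = sumTo-zero n λ k 1≤k k≤n → 𝟙-no (pos k ℤ.≟ b) λ eq → b∉ (subst (InRange n) eq (pos-inRange 1≤k k≤n))

-- For v ≥ 0 the admissible entries are the first n ∸ v of the range, for v < 0 the last n ∸ |v|.
count-shift : ∀ n v → ∑ (range n) (λ a → 𝟙 (inRange? n (a ℤ.+ v))) ≡ fromℕ (n ℕ.∸ ∣ v ∣)
count-shift n v = trans (∑-range n (λ a → 𝟙 (inRange? n (a ℤ.+ v)))) (go v)
  where
  go : ∀ v → sumTo n (λ k → 𝟙 (inRange? n (pos k ℤ.+ v))) ≡ fromℕ (n ℕ.∸ ∣ v ∣)
  go (pos w) = count-≤ (ℕ.m∸n≤m n w)
    (λ k 1≤k k≤n∸w → 𝟙-yes (inRange? n (pos (k ℕ.+ w))) (pos-inRange (ℕ.≤-trans 1≤k (ℕ.m≤m+n k w))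
      (ℕ.≤-trans (ℕ.+-monoˡ-≤ w k≤n∸w) (ℕ.≤-reflexive (ℕ.m∸n+n≡m {n} {w} (ℕ.<⇒≤ (ℕ.m∸n≢0⇒n<m λ eq →
        contradiction (subst (1 ℕ.≤_) eq (ℕ.≤-trans 1≤k k≤n∸w)) λ ())))))))
    (λ k n∸w<k → 𝟙-no (inRange? n (pos (k ℕ.+ w))) λ (_ , k+w≤n) →
      ℕ.<⇒≱ n∸w<k (ℕ.m+n≤o⇒m≤o∸n k (ℤ.drop‿+≤+ k+w≤n)))
  go -[1+ w ] = count-> {m = suc w} n
    (λ k _ k≤1+w → 𝟙-no (inRange? n (pos k ℤ.+ -[1+ w ])) λ (1≤k-w , _) →
      ℤ.<⇒≱ (ℤ.+<+ (s≤s z≤n)) (ℤ.≤-trans 1≤k-w (ℤ.i≤j⇒i-j≤0 {pos k} {pos (suc w)} (ℤ.+≤+ k≤1+w))))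
    (λ k 1+w<k k≤n → 𝟙-yes (inRange? n (pos k ℤ.+ -[1+ w ])) (subst (InRange n) (sym (ℤ.⊖-≥ (ℕ.<⇒≤ 1+w<k)))
      (pos-inRange (ℕ.m<n⇒0<n∸m 1+w<k) (ℕ.≤-trans (ℕ.m∸n≤m k (suc w)) k≤n))))

-- The board

choose-All : ∀ {A : Set} {P : A → Set} q {X} → All P X → All (All P) (choose q X)
choose-All zero    _          = [] ∷ []
choose-All (suc q) []         = []
choose-All (suc q) (px ∷ pxs) = All.++⁺ (All.map⁺ (All.map (px ∷_) (choose-All q pxs))) (choose-All (suc q) pxs)

filter-map-∷-accept : ∀ {A : Set} {P : A → Set} (P? : ∀ x → Dec (P x)) {x} → P x → ∀ L →
  filter (all? P?) (map (x ∷_) L) ≡ map (x ∷_) (filter (all? P?) L)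
filter-map-∷-accept P? px []      = refl
filter-map-∷-accept {P = P} P? {x} px (S ∷ L) = go (all? P? S)
  where
  ih = filter-map-∷-accept P? px L
  go : Dec (All P S) → filter (all? P?) (map (x ∷_) (S ∷ L)) ≡ map (x ∷_) (filter (all? P?) (S ∷ L))
  go (yes pS) = trans (filter-accept (all? P?) (px ∷ pS))
    (trans (cong ((x ∷ S) ∷_) ih) (cong (map (x ∷_)) (sym (filter-accept (all? P?) pS))))
  go (no ¬pS) = trans (filter-reject (all? P?) λ pxS → ¬pS (All.tail pxS))
    (trans ih (cong (map (x ∷_)) (sym (filter-reject (all? P?) ¬pS))))

filter-map-∷-reject : ∀ {A : Set} {P : A → Set} (P? : ∀ x → Dec (P x)) {x} → ¬ P x → ∀ L →
  filter (all? P?) (map (x ∷_) L) ≡ []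
filter-map-∷-reject P? ¬px []      = refl
filter-map-∷-reject P? ¬px (S ∷ L) = trans (filter-reject (all? P?) λ pxS → ¬px (All.head pxS)) (filter-map-∷-reject P? ¬px L)

-- With P the property of lying off the line of a given point, this turns a condition on selections
-- into the removal of a class.
choose-filter : ∀ {A : Set} {P : A → Set} (P? : ∀ x → Dec (P x)) q X →
  filter (all? P?) (choose q X) ≡ choose q (filter P? X)
choose-filter P? zero    X       = refl
choose-filter P? (suc q) []      = refl
choose-filter {P = P} P? (suc q) (x ∷ X) = trans (filter-++ (all? P?) (map (x ∷_) (choose q X)) (choose (suc q) X)) (go (P? x))
  where
  go : Dec (P x) → filter (all? P?) (map (x ∷_) (choose q X)) ++ filter (all? P?) (choose (suc q) X) ≡ choose (suc q) (filter P? (x ∷ X))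
  go (yes px) = trans (cong₂ _++_ (trans (filter-map-∷-accept P? px (choose q X)) (cong (map (x ∷_)) (choose-filter P? q X)))
                                  (choose-filter P? (suc q) X))
                      (cong (choose (suc q)) (sym (filter-accept P? px)))
  go (no ¬px) = trans (cong₂ _++_ (filter-map-∷-reject P? ¬px (choose q X)) (choose-filter P? (suc q) X))
                      (cong (choose (suc q)) (sym (filter-reject P? ¬px)))

-- Lines in the direction of the move

shift-0 : ∀ z m → shift z 0ℤ m ≡ z
shift-0 (x , y) (c , d) = cong₂ _,_ (lemma x c) (lemma y d)
  where
  lemma : ∀ x c → x ℤ.+ 0ℤ ℤ.* c ≡ x
  lemma = ℤ.solve-∀

shift-shift : ∀ z k l m → shift (shift z k m) l m ≡ shift z (k ℤ.+ l) m
shift-shift (x , y) k l (c , d) = cong₂ _,_ (lemma x k l c) (lemma y k l d)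
  where
  lemma : ∀ x k l c → (x ℤ.+ k ℤ.* c) ℤ.+ l ℤ.* c ≡ x ℤ.+ (k ℤ.+ l) ℤ.* c
  lemma = ℤ.solve-∀

shift-neg : ∀ z k m → shift (shift z k m) (ℤ.- k) m ≡ z
shift-neg z k m = trans (shift-shift z k (ℤ.- k) m) (trans (cong (λ l → shift z l m) (ℤ.+-inverseʳ k)) (shift-0 z m))

-- `Attacks` excludes k = 0. Admitting it gives an equivalence relation, whose classes are the lines
-- in direction m.
data Collinear (m z w : Point) : Set where
  by : ∀ k → w ≡ shift z k m → Collinear m z w

module Lines (m : Point) where

  Collinear-refl : ∀ {z} → Collinear m z z
  Collinear-refl {z} = by 0ℤ (sym (shift-0 z m))

  Collinear-sym : ∀ {z w} → Collinear m z w → Collinear m w z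
  Collinear-sym {z} (by k refl) = by (ℤ.- k) (sym (shift-neg z k m))

  Collinear-trans : ∀ {z w v} → Collinear m z w → Collinear m w v → Collinear m z v
  Collinear-trans {z} (by k refl) (by l refl) = by (k ℤ.+ l) (shift-shift z k l m)

  attacks⇒collinear : ∀ {z w} → Attacks m z w → Collinear m z w
  attacks⇒collinear (k , _ , eq) = by k eq

  collinear⇒attacks : ∀ {z w} → z ≢ w → Collinear m z w → Attacks m z w
  collinear⇒attacks {z} z≢w (by k eq) =
    k , (λ k≡0 → z≢w (sym (trans eq (trans (cong (λ l → shift z l m) k≡0) (shift-0 z m))))) , eq

  collinear? : ∀ z w → Dec (Collinear m z w)
  collinear? z w = go (z ≟ₚ w) (attacks? m z w)
    where
    go : Dec (z ≡ w) → Dec (Attacks m z w) → Dec (Collinear m z w)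
    go (yes refl) _        = yes Collinear-refl
    go (no z≢w)   (yes at) = yes (attacks⇒collinear at)
    go (no z≢w)   (no ¬at) = no λ z∼w → ¬at (collinear⇒attacks z≢w z∼w)

  open Classes (Collinear m) collinear? Collinear-refl Collinear-sym Collinear-trans public

  nonattacking-∷⁻ : ∀ {x S} → All (x ≢_) S → Nonattacking m (x ∷ S) →
    Nonattacking m S × All (λ w → ¬ Collinear m x w) S
  nonattacking-∷⁻ x∉S ((_ ∷ x-safe) ∷ S-safe) = All.map All.tail S-safe ,
    All.zipWith (λ (x≢w , safe) x∼w → safe x≢w (collinear⇒attacks x≢w x∼w)) (x∉S , x-safe)

  nonattacking-∷⁺ : ∀ {x S} → Nonattacking m S → All (λ w → ¬ Collinear m x w) S → Nonattacking m (x ∷ S)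
  nonattacking-∷⁺ S-safe x≁S =
    ((λ x≢x → contradiction refl x≢x) ∷ All.map (λ x≁w _ at → x≁w (attacks⇒collinear at)) x≁S) ∷
    All.zipWith (λ (x≁w , safe) → (λ _ at → x≁w (Collinear-sym (attacks⇒collinear at))) ∷ safe) (x≁S , S-safe)

  private
    NA? = nonattacking? m

    noncollinear? : ∀ x w → Dec (¬ Collinear m x w)
    noncollinear? x w = ¬? (collinear? x w)

  filter-nonattacking-∷ : ∀ {x L} → All (All (x ≢_)) L →
    length (filter NA? (map (x ∷_) L)) ≡ length (filter NA? (filter (all? (noncollinear? x)) L))
  filter-nonattacking-∷ [] = refl
  filter-nonattacking-∷ {x} {S ∷ L} (x∉S ∷ x∉L) = go (NA? S) (all? (noncollinear? x) S)
    where
    ih = filter-nonattacking-∷ x∉L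
    go : Dec (Nonattacking m S) → Dec (All (λ w → ¬ Collinear m x w) S) →
      length (filter NA? (map (x ∷_) (S ∷ L))) ≡ length (filter NA? (filter (all? (noncollinear? x)) (S ∷ L)))
    go (yes safe) (yes x≁S) = trans (cong length (filter-accept NA? (nonattacking-∷⁺ safe x≁S))) (trans (cong suc ih)
      (cong length (sym (trans (cong (filter NA?) (filter-accept (all? (noncollinear? x)) x≁S)) (filter-accept NA? safe)))))
    go (no ¬safe) (yes x≁S) = trans (cong length (filter-reject NA? λ safe → ¬safe (proj₁ (nonattacking-∷⁻ x∉S safe)))) (trans ih
      (cong length (sym (trans (cong (filter NA?) (filter-accept (all? (noncollinear? x)) x≁S)) (filter-reject NA? ¬safe)))))
    go _ (no ¬x≁S) = trans (cong length (filter-reject NA? λ safe → ¬x≁S (proj₂ (nonattacking-∷⁻ x∉S safe)))) (trans ih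
      (cong length (cong (filter NA?) (sym (filter-reject (all? (noncollinear? x)) ¬x≁S)))))

  -- `choose` and `e` recurse alike: a selection containing x is nonattacking exactly when its other
  -- points are nonattacking and lie off the line of x.
  count-nonattacking : ∀ q {X} → AllPairs _≢_ X → fromℕ (length (filter NA? (choose q X))) ≡ e q X
  count-nonattacking zero    _  = refl
  count-nonattacking (suc q) [] = refl
  count-nonattacking (suc q) {x ∷ X} (x∉X ∷ X-unique) = begin
    fromℕ (length (filter NA? (map (x ∷_) (choose q X) ++ choose (suc q) X)))
      ≡⟨ cong (λ L → fromℕ (length L)) (filter-++ NA? (map (x ∷_) (choose q X)) (choose (suc q) X)) ⟩
    fromℕ (length (filter NA? (map (x ∷_) (choose q X)) ++ filter NA? (choose (suc q) X)))
      ≡⟨ cong fromℕ (trans (length-++ (filter NA? (map (x ∷_) (choose q X))))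
           (cong (ℕ._+ length (filter NA? (choose (suc q) X))) (trans (filter-nonattacking-∷ (choose-All q x∉X))
             (cong (λ L → length (filter NA? L)) (choose-filter (noncollinear? x) q X))))) ⟩
    fromℕ (length (filter NA? (choose q (without x X))) ℕ.+ length (filter NA? (choose (suc q) X)))
      ≡⟨ fromℕ-+ (length (filter NA? (choose q (without x X)))) (length (filter NA? (choose (suc q) X))) ⟩
    fromℕ (length (filter NA? (choose q (without x X)))) + fromℕ (length (filter NA? (choose (suc q) X)))
      ≡⟨ cong₂ _+_ (count-nonattacking q (AllPairs.filter⁺ (noncollinear? x) X-unique)) (count-nonattacking (suc q) X-unique) ⟩
    e q (without x X) + e (suc q) X
      ≡⟨ +-comm (e q (without x X)) (e (suc q) X) ⟩
    e (suc q) X + e q (without x X) ∎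
    where open ≡-Reasoning

-- The lexicographic order along lines

data Lex : Point → Point → Set where
  first  : ∀ {x y x′ y′} → x ℤ.< x′ → Lex (x , y) (x′ , y′)
  second : ∀ {x y x′ y′} → x ≡ x′ → y ℤ.< y′ → Lex (x , y) (x′ , y′)

Lex-asym : ∀ {z w} → Lex z w → ¬ Lex w z
Lex-asym (first p)       (first q)       = ℤ.<-asym p q
Lex-asym (first p)       (second refl _) = ℤ.<-irrefl refl p
Lex-asym (second refl _) (first q)       = ℤ.<-irrefl refl q
Lex-asym (second _ p)    (second _ q)    = ℤ.<-asym p q

Lex⇒≢ : ∀ {z w} → Lex z w → z ≢ w
Lex⇒≢ z<w refl = Lex-asym z<w z<w

-- Every nonzero move has this form up to sign. The order in which `board` lists its points is then
-- the order along each line: the points of the line that come after z are z + k m with k > 0.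
data LexPositive : Point → Set where
  first  : ∀ {c d} → LexPositive (pos (suc c) , d)
  second : ∀ {d} → LexPositive (0ℤ , pos (suc d))

shift-mono : ∀ {m} → LexPositive m → ∀ z {k l} → k ℤ.< l → Lex (shift z k m) (shift z l m)
shift-mono (first {c}) (x , y) k<l = first (ℤ.+-monoʳ-< x (ℤ.*-monoʳ-<-pos (pos (suc c)) k<l))
shift-mono (second {d}) (x , y) {k} {l} k<l = second
  (cong (λ v → x ℤ.+ v) (trans (ℤ.*-zeroʳ k) (sym (ℤ.*-zeroʳ l)))) (ℤ.+-monoʳ-< y (ℤ.*-monoʳ-<-pos (pos (suc d)) k<l))

InBoard : ℕ → Point → Set
InBoard n z = InRange n (proj₁ z) × InRange n (proj₂ z)

inBoard? : ∀ n z → Dec (InBoard n z)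
inBoard? n z = inRange? n (proj₁ z) ×-dec inRange? n (proj₂ z)

-- Some coordinate of the move is at least 1, so k moves cover at least k columns or rows. Hence
-- sums over k up to n miss no point of a line.
shift-length : ∀ {m n} → LexPositive m → ∀ z k → InBoard n z → InBoard n (shift z (pos k) m) → k ℕ.≤ n
shift-length {m} {n} m>0 (x , y) k (x∈ , y∈) (x′∈ , y′∈) = go m>0 x′∈ y′∈
  where
  bound : ∀ {a} c → InRange n a → InRange n (a ℤ.+ pos k ℤ.* pos (suc c)) → k ℕ.≤ n
  bound {pos a} c (1≤a , _) (_ , a+kc≤n) = ℕ.≤-trans (ℕ.m≤m*n k (suc c)) (ℕ.≤-trans (ℕ.m≤n+m (k ℕ.* suc c) a)
    (ℤ.drop‿+≤+ (subst (ℤ._≤ pos n) (cong (λ v → pos a ℤ.+ v) (sym (ℤ.pos-* k (suc c)))) a+kc≤n)))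
  go : ∀ {m} → LexPositive m → InRange n (x ℤ.+ pos k ℤ.* proj₁ m) → InRange n (y ℤ.+ pos k ℤ.* proj₂ m) → k ℕ.≤ n
  go (first {c})  x′∈ _   = bound c x∈ x′∈
  go (second {d}) _   y′∈ = bound d y∈ y′∈

-- The coordinate is monotone in k, in a direction given by the sign of `c`, and so lies between its
-- values at 0 and k + 1.
inRange-convex : ∀ {n a c} k → InRange n a → InRange n (a ℤ.+ pos (suc k) ℤ.* c) → InRange n (a ℤ.+ pos k ℤ.* c)
inRange-convex {n} {a} {pos c} k (1≤a , _) (_ , end≤n) =
  ℤ.≤-trans 1≤a (subst (λ v → a ℤ.≤ a ℤ.+ v) (ℤ.pos-* k c) (ℤ.i≤i+j a (pos (k ℕ.* c)))) ,
  ℤ.≤-trans (ℤ.+-monoʳ-≤ a (ℤ.*-monoʳ-≤-nonNeg (pos c) (ℤ.+≤+ (ℕ.n≤1+n k)))) end≤n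
inRange-convex {n} {a} { -[1+ c ]} k (_ , a≤n) (1≤end , _) =
  ℤ.≤-trans 1≤end (ℤ.+-monoʳ-≤ a (ℤ.*-monoʳ-≤-nonPos -[1+ c ] (ℤ.+≤+ (ℕ.n≤1+n k)))) ,
  ℤ.≤-trans (subst (a ℤ.+ pos k ℤ.* -[1+ c ] ℤ.≤_) (ℤ.+-identityʳ a)
    (ℤ.+-monoʳ-≤ a (ℤ.*-monoʳ-≤-nonPos -[1+ c ] {pos 0} {pos k} (ℤ.+≤+ z≤n)))) a≤n

range-inRange : ∀ n → All (InRange n) (range n)
range-inRange n = All.map⁺ (All.applyUpTo⁺₁ (λ i → i) n λ i<n → pos-inRange (s≤s z≤n) i<n)

range-sorted : ∀ n → AllPairs ℤ._<_ (range n)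
range-sorted n = AllPairs.map⁺ (AllPairs.applyUpTo⁺₁ (λ i → i) n λ i<j _ → ℤ.+<+ (s≤s i<j))

product-All : ∀ {A B : Set} {P : A → Set} {Q : B → Set} {xs ys} → All P xs → All Q ys →
  All (λ z → P (proj₁ z) × Q (proj₂ z)) (cartesianProduct xs ys)
product-All []         qys = []
product-All (px ∷ pxs) qys = All.++⁺ (All.map⁺ (All.map (px ,_) qys)) (product-All pxs qys)

product-sorted : ∀ {xs ys} → AllPairs ℤ._<_ xs → AllPairs ℤ._<_ ys → AllPairs Lex (cartesianProduct xs ys)
product-sorted [] ys-sorted = []
product-sorted {x ∷ xs} {ys} (x<xs ∷ xs-sorted) ys-sorted = AllPairs.++⁺
  (AllPairs.map⁺ (AllPairs.map (second refl) ys-sorted)) (product-sorted xs-sorted ys-sorted)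
  -- Only first coordinates are compared here; the constant predicate `ℚ` with witness 0 stands in
  -- for a condition on the second.
  (All.map⁺ (All.universal (λ _ → All.map (λ (x<x′ , _) → first x<x′)
    (product-All x<xs (All.universal {P = λ _ → ℚ} (λ _ → 0ℚ) ys))) ys))

board-inBoard : ∀ n → All (InBoard n) (board n n)
board-inBoard n = product-All (range-inRange n) (range-inRange n)

board-sorted : ∀ n → AllPairs Lex (board n n)
board-sorted n = product-sorted (range-sorted n) (range-sorted n)

AllPairs-with-All : ∀ {A : Set} {R : A → A → Set} {P : A → Set} {xs} → All P xs → AllPairs R xs →
  AllPairs (λ x y → R x y × P x × P y) xs
AllPairs-with-All []         []         = []
AllPairs-with-All (px ∷ pxs) (rx ∷ rxs) = All.zipWith (λ (r , p) → r , px , p) (rx , pxs) ∷ AllPairs-with-All pxs rxs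

𝟙-× : ∀ {P Q : Set} (d : Dec P) (d′ : Dec Q) → 𝟙 (d ×-dec d′) ≡ 𝟙 d * 𝟙 d′
𝟙-× (yes _) (yes _) = refl
𝟙-× (yes _) (no _)  = refl
𝟙-× (no _)  (yes _) = refl
𝟙-× (no _)  (no _)  = refl

∑-board-≟ : ∀ n z → ∑ (board n n) (λ w → 𝟙 (w ≟ₚ z)) ≡ 𝟙 (inBoard? n z)
∑-board-≟ n z@(x , y) = begin
  ∑ (board n n) (λ w → 𝟙 (w ≟ₚ z))
    ≡⟨ ∑-cong (board n n) (λ w → trans
         (𝟙-⇔ (w ≟ₚ z) (proj₁ w ℤ.≟ x ×-dec proj₂ w ℤ.≟ y) (λ eq → cong proj₁ eq , cong proj₂ eq) (λ (p , q) → cong₂ _,_ p q))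
         (𝟙-× (proj₁ w ℤ.≟ x) (proj₂ w ℤ.≟ y))) ⟩
  ∑ (board n n) (λ w → 𝟙 (proj₁ w ℤ.≟ x) * 𝟙 (proj₂ w ℤ.≟ y))
    ≡⟨ ∑-product (λ a → 𝟙 (a ℤ.≟ x)) (λ b → 𝟙 (b ℤ.≟ y)) (range n) (range n) ⟩
  ∑ (range n) (λ a → 𝟙 (a ℤ.≟ x)) * ∑ (range n) (λ b → 𝟙 (b ℤ.≟ y))
    ≡⟨ cong₂ _*_ (∑-range-≟ n x) (∑-range-≟ n y) ⟩
  𝟙 (inRange? n x) * 𝟙 (inRange? n y)
    ≡⟨ 𝟙-× (inRange? n x) (inRange? n y) ⟨
  𝟙 (inBoard? n z) ∎
  where open ≡-Reasoning

count-board-shift : ∀ n k c d → ∑ (board n n) (λ z → 𝟙 (inBoard? n (shift z (pos k) (c , d)))) ≡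
  fromℕ (n ℕ.∸ k ℕ.* ∣ c ∣) * fromℕ (n ℕ.∸ k ℕ.* ∣ d ∣)
count-board-shift n k c d = begin
  ∑ (board n n) (λ z → 𝟙 (inBoard? n (shift z (pos k) (c , d))))
    ≡⟨ ∑-cong (board n n) (λ z → 𝟙-× (inRange? n (proj₁ z ℤ.+ pos k ℤ.* c)) (inRange? n (proj₂ z ℤ.+ pos k ℤ.* d))) ⟩
  ∑ (board n n) (λ z → 𝟙 (inRange? n (proj₁ z ℤ.+ pos k ℤ.* c)) * 𝟙 (inRange? n (proj₂ z ℤ.+ pos k ℤ.* d)))
    ≡⟨ ∑-product (λ a → 𝟙 (inRange? n (a ℤ.+ pos k ℤ.* c))) (λ b → 𝟙 (inRange? n (b ℤ.+ pos k ℤ.* d))) (range n) (range n) ⟩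
  ∑ (range n) (λ a → 𝟙 (inRange? n (a ℤ.+ pos k ℤ.* c))) * ∑ (range n) (λ b → 𝟙 (inRange? n (b ℤ.+ pos k ℤ.* d)))
    ≡⟨ cong₂ _*_ (side c) (side d) ⟩
  fromℕ (n ℕ.∸ k ℕ.* ∣ c ∣) * fromℕ (n ℕ.∸ k ℕ.* ∣ d ∣) ∎
  where
  open ≡-Reasoning
  side : ∀ c → ∑ (range n) (λ a → 𝟙 (inRange? n (a ℤ.+ pos k ℤ.* c))) ≡ fromℕ (n ℕ.∸ k ℕ.* ∣ c ∣)
  side c = trans (count-shift n (pos k ℤ.* c)) (cong (λ v → fromℕ (n ℕ.∸ v)) (ℤ.abs-* (pos k) c))

count-board : ∀ n → ∑ (board n n) (λ _ → 1ℚ) ≡ fromℕ n * fromℕ n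
count-board n = trans (∑-product (λ _ → 1ℚ) (λ _ → 1ℚ) (range n) (range n)) (cong₂ _*_ side side)
  where
  side : ∑ (range n) (λ _ → 1ℚ) ≡ fromℕ n
  side = trans (∑-range n (λ _ → 1ℚ)) (sumTo-const n)

-- Power sums of line sizes on the board

module BoardPowerSums (c d : ℤ) (m>0 : LexPositive (c , d)) (n : ℕ) where

  m : Point
  m = c , d

  open Lines m

  -- At most one k fits, so for distinct board points on a line this indicates which comes first.
  -- Being a sum over k, it allows the order of summation to be exchanged in `∑-ρ`.
  ρ : Point → Point → ℚ
  ρ z w = sumTo n λ k → 𝟙 (w ≟ₚ shift z (pos k) m)

  z<z+km : ∀ z k → Lex z (shift z (pos (suc k)) m)
  z<z+km z k = subst (λ w → Lex w (shift z (pos (suc k)) m)) (shift-0 z m) (shift-mono m>0 z {0ℤ} {pos (suc k)} (ℤ.+<+ (s≤s z≤n)))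

  ρ-irrefl : ∀ z → ρ z z ≡ 0ℚ
  ρ-irrefl z = sumTo-zero n λ { (suc k) _ _ → 𝟙-no (z ≟ₚ shift z (pos (suc k)) m) (Lex⇒≢ (z<z+km z k)) }

  shift-injective : ∀ z k l → shift z (pos k) m ≡ shift z (pos l) m → k ≡ l
  shift-injective z k l eq = go (ℕ.<-cmp k l)
    where
    go : _ → k ≡ l
    go (tri< k<l _ _) = contradiction eq (Lex⇒≢ (shift-mono m>0 z (ℤ.+<+ k<l)))
    go (tri≈ _ k≡l _) = k≡l
    go (tri> _ _ l<k) = contradiction (sym eq) (Lex⇒≢ (shift-mono m>0 z (ℤ.+<+ l<k)))

  ρ-later : ∀ {z w} → Lex z w × InBoard n z × InBoard n w → 𝟙 (collinear? z w) ≡ ρ z w × ρ w z ≡ 0ℚ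
  ρ-later {z} {w} (z<w , z∈ , w∈) = go (collinear? z w) , sumTo-zero n λ where
      (suc k) _ _ → 𝟙-no (z ≟ₚ shift w (pos (suc k)) m) λ eq → Lex-asym z<w (subst (Lex w) (sym eq) (z<z+km w k))
    where
    go : (z∼?w : Dec (Collinear m z w)) → 𝟙 z∼?w ≡ ρ z w
    go (yes (by (pos zero) eq)) = contradiction (sym (trans eq (shift-0 z m))) (Lex⇒≢ z<w)
    go (yes (by (pos (suc k)) refl)) = sym (sumTo-unique n (s≤s z≤n) (shift-length m>0 z (suc k) z∈ w∈)
      (𝟙-yes (shift z (pos (suc k)) m ≟ₚ shift z (pos (suc k)) m) refl)
      λ l l≢k → 𝟙-no (shift z (pos (suc k)) m ≟ₚ shift z (pos l) m) λ eq → l≢k (sym (shift-injective z (suc k) l eq)))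
    go (yes (by -[1+ k ] refl)) = contradiction
      (subst (Lex w) (shift-neg z -[1+ k ] m) (z<z+km w k)) (Lex-asym z<w)
    go (no z≁w) = sym (sumTo-zero n λ k _ _ → 𝟙-no (w ≟ₚ shift z (pos k) m) λ eq → z≁w (by (pos k) eq))

  ∑-ρ : ∀ z → ∑ (board n n) (ρ z) ≡ sumTo n (λ k → 𝟙 (inBoard? n (shift z (pos k) m)))
  ∑-ρ z = trans (∑-sumTo (λ w k → 𝟙 (w ≟ₚ shift z (pos k) m)) n (board n n))
    (sumTo-cong n λ k _ _ → ∑-board-≟ n (shift z (pos k) m))

  Δpow-0 : ∀ j → Δpow j 0ℚ ≡ 1ℚ
  Δpow-0 j = trans (cong₂ _-_ (pow-1 (suc j)) (*-zeroˡ (pow j 0ℚ))) refl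
    where
    pow-1 : ∀ j → pow j (0ℚ + 1ℚ) ≡ 1ℚ
    pow-1 zero    = refl
    pow-1 (suc j) = trans (cong₂ _*_ (+-identityˡ 1ℚ) (pow-1 j)) (*-identityˡ 1ℚ)

  count : ℕ → ℚ
  count k = fromℕ (n ℕ.∸ k ℕ.* ∣ c ∣) * fromℕ (n ℕ.∸ k ℕ.* ∣ d ∣)

  powerSumOf-board : ∀ j → powerSumOf (board n n) j ≡
    fromℕ n * fromℕ n + sumTo n (λ k → Δ²pow j (fromℕ k) * count k)
  powerSumOf-board j = begin
    powerSumOf (board n n) j
      ≡⟨ powerSumOf-ordered ρ ρ-irrefl ρ-later j (AllPairs-with-All (board-inBoard n) (board-sorted n)) ⟩
    ∑ (board n n) (λ z → Δpow j (∑ (board n n) (ρ z)))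
      ≡⟨ ∑-cong-All (All.map (λ {z} z∈ → expand z z∈) (board-inBoard n)) ⟩
    ∑ (board n n) (λ z → 1ℚ + sumTo n (λ k → Δ²pow j (fromℕ k) * χ z k))
      ≡⟨ ∑-+ (λ _ → 1ℚ) (λ z → sumTo n (λ k → Δ²pow j (fromℕ k) * χ z k)) (board n n) ⟩
    ∑ (board n n) (λ _ → 1ℚ) + ∑ (board n n) (λ z → sumTo n (λ k → Δ²pow j (fromℕ k) * χ z k))
      ≡⟨ cong₂ _+_ (count-board n) (trans (∑-sumTo (λ z k → Δ²pow j (fromℕ k) * χ z k) n (board n n))
           (sumTo-cong n λ k _ _ → trans (∑-*ˡ (Δ²pow j (fromℕ k)) (λ z → χ z k) (board n n))
             (cong (Δ²pow j (fromℕ k) *_) (count-board-shift n k c d)))) ⟩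
    fromℕ n * fromℕ n + sumTo n (λ k → Δ²pow j (fromℕ k) * count k) ∎
    where
    open ≡-Reasoning
    χ : Point → ℕ → ℚ
    χ z k = 𝟙 (inBoard? n (shift z (pos k) m))
    expand : ∀ z → InBoard n z → Δpow j (∑ (board n n) (ρ z)) ≡ 1ℚ + sumTo n (λ k → Δ²pow j (fromℕ k) * χ z k)
    -- The later points on the line of z are those z + k m with k in an initial segment, by
    -- convexity of the board; so summation by parts applies to `Δpow j` of their number. The
    -- initial values 1 then add up to n ^ 2.
    expand z (x∈ , y∈) = trans (cong (Δpow j) (∑-ρ z)) (trans
      (sumTo-initial (λ k → inBoard? n (shift z (pos k) m))
        (λ k (x′∈ , y′∈) → inRange-convex {c = c} (suc k) x∈ x′∈ , inRange-convex {c = d} (suc k) y∈ y′∈) (Δpow j) n)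
      (cong₂ _+_ (Δpow-0 j) (sumTo-cong n λ k _ _ → *-comm (χ z k) (Δ²pow j (fromℕ k)))))

  u-formula : ∀ q → fromℕ (u m q n n) ≡
    elementary (λ j → fromℕ n * fromℕ n + sumTo n (λ k → Δ²pow j (fromℕ k) * count k)) q
  u-formula q = trans (count-nonattacking q (AllPairs.map Lex⇒≢ (board-sorted n)))
    (trans (e≡elementary q (board n n)) (elementary-cong powerSumOf-board q))

-- The period of the rider, up to the sign of its move

HasPeriod-resp : ∀ {f h p} → (∀ n → f n ≡ h n) → HasPeriod f p → HasPeriod h p
HasPeriod-resp f≗h ((p≢0 , fs , f≡fs) , minimal) =
  (p≢0 , fs , λ n 1≤n → trans (sym (f≗h n)) (f≡fs n 1≤n)) ,
  λ p′ (p′≢0 , fs′ , h≡fs′) → minimal p′ (p′≢0 , fs′ , λ n 1≤n → trans (f≗h n) (h≡fs′ n 1≤n))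

-- A common divisor excludes the degenerate cases: 2 if a = M = 0, and M itself if a = M > 1.
hasPeriod-of-formula : ∀ a M → ℕ.Coprime a M → a ≤ M → ∀ q f →
  (∀ n → f n ≡ elementary (λ j → fromℕ n * fromℕ n + sumTo n λ k →
    Δ²pow j (fromℕ k) * (fromℕ (n ℕ.∸ k ℕ.* a) * fromℕ (n ℕ.∸ k ℕ.* M))) (suc (suc q))) →
  HasPeriod f M
hasPeriod-of-formula a zero    coprime z≤n = contradiction (coprime {2} (2 ∣0 , 2 ∣0)) λ ()
hasPeriod-of-formula a (suc m) coprime a≤1+m q f = Period.hasPeriod a m a≤1+m a<1+m q f
  where
  a<1+m : 1 ≤ m → a ℕ.< suc m
  a<1+m 1≤m = ℕ.≤∧≢⇒< a≤1+m λ { refl →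
    ℕ.<⇒≢ 1≤m (sym (ℕ.suc-injective (coprime (∣-refl , ∣-refl)))) }

hasPeriod-lexPositive : ∀ c d → LexPositive (c , d) → Coprime c d → ∀ q →
  HasPeriod (λ n → fromℕ (u (c , d) (suc (suc q)) n n)) (∣ c ∣ ⊔ ∣ d ∣)
hasPeriod-lexPositive c d m>0 coprime q = go (ℕ.≤-total ∣ c ∣ ∣ d ∣)
  where
  f : ℕ → ℚ
  f n = fromℕ (u (c , d) (suc (suc q)) n n)
  formula : ∀ n → f n ≡ _
  formula n = BoardPowerSums.u-formula c d m>0 n (suc (suc q))
  go : ∣ c ∣ ≤ ∣ d ∣ ⊎ ∣ d ∣ ≤ ∣ c ∣ → HasPeriod f (∣ c ∣ ⊔ ∣ d ∣)
  go (inj₁ c≤d) = subst (HasPeriod f) (sym (ℕ.m≤n⇒m⊔n≡n c≤d))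
    (hasPeriod-of-formula ∣ c ∣ ∣ d ∣ coprime c≤d q f formula)
  go (inj₂ d≤c) = subst (HasPeriod f) (sym (ℕ.m≥n⇒m⊔n≡m d≤c))
    (hasPeriod-of-formula ∣ d ∣ ∣ c ∣ (ℕ.sym coprime) d≤c q f λ n → trans (formula n)
      (elementary-cong (λ j → cong (fromℕ n * fromℕ n +_) (sumTo-cong n λ k _ _ → cong (Δ²pow j (fromℕ k) *_)
        (*-comm (fromℕ (n ℕ.∸ k ℕ.* ∣ c ∣)) (fromℕ (n ℕ.∸ k ℕ.* ∣ d ∣))))) (suc (suc q))))

-- Passing from k to - k compensates the sign of the move, which reduces the theorem to
-- lexicographically positive moves.
attacks-neg : ∀ c d {z w} → Attacks (c , d) z w → Attacks (ℤ.- c , ℤ.- d) z w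
attacks-neg c d {x , y} (k , k≢0 , eq) = ℤ.- k ,
  (λ -k≡0 → k≢0 (trans (sym (ℤ.neg-involutive k)) (cong ℤ.-_ -k≡0))) ,
  trans eq (cong₂ _,_ (lemma x k c) (lemma y k d))
  where
  lemma : ∀ x k c → x ℤ.+ k ℤ.* c ≡ x ℤ.+ (ℤ.- k) ℤ.* (ℤ.- c)
  lemma = ℤ.solve-∀

nonattacking-neg : ∀ c d {S} → Nonattacking (ℤ.- c , ℤ.- d) S → Nonattacking (c , d) S
nonattacking-neg c d = All.map λ {z} → All.map λ {w} safe z≢w at → safe z≢w (attacks-neg c d {z} {w} at)

u-neg : ∀ c d q m n → u (ℤ.- c , ℤ.- d) q m n ≡ u (c , d) q m n
u-neg c d q m n = cong length (filter-≐ (nonattacking? (ℤ.- c , ℤ.- d)) (nonattacking? (c , d))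
  (nonattacking-neg c d , λ safe → nonattacking-neg (ℤ.- c) (ℤ.- d)
    (subst (λ v → Nonattacking v _) (sym (cong₂ _,_ (ℤ.neg-involutive c) (ℤ.neg-involutive d))) safe))
  (choose q (board m n)))

hasPeriod-neg : ∀ c d → LexPositive (ℤ.- c , ℤ.- d) → Coprime c d → ∀ q →
  HasPeriod (λ n → fromℕ (u (c , d) (suc (suc q)) n n)) (∣ c ∣ ⊔ ∣ d ∣)
hasPeriod-neg c d -m>0 coprime q = HasPeriod-resp (λ n → cong fromℕ (u-neg c d (suc (suc q)) n n))
  (subst (HasPeriod _) (cong₂ _⊔_ (ℤ.∣-i∣≡∣i∣ c) (ℤ.∣-i∣≡∣i∣ d))
    (hasPeriod-lexPositive (ℤ.- c) (ℤ.- d) -m>0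
      (subst₂ ℕ.Coprime (sym (ℤ.∣-i∣≡∣i∣ c)) (sym (ℤ.∣-i∣≡∣i∣ d)) coprime) q))

theorem3p2 : (c d : ℤ) → Coprime c d → (q : ℕ) → 2 ≤ q →
    HasPeriod (λ n → fromℕ (u (c , d) q n n)) (∣ c ∣ ⊔ ∣ d ∣)
theorem3p2 (pos (suc c)) d coprime (suc (suc q)) (s≤s (s≤s z≤n)) = hasPeriod-lexPositive _ d first coprime q
theorem3p2 (pos zero) (pos (suc d)) coprime (suc (suc q)) (s≤s (s≤s z≤n)) = hasPeriod-lexPositive _ _ second coprime q
theorem3p2 (pos zero) (pos zero) coprime (suc (suc q)) (s≤s (s≤s z≤n)) = contradiction (coprime {2} (2 ∣0 , 2 ∣0)) λ ()
theorem3p2 (pos zero) -[1+ d ] coprime (suc (suc q)) (s≤s (s≤s z≤n)) = hasPeriod-neg (pos zero) -[1+ d ] second coprime q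
theorem3p2 -[1+ c ] d coprime (suc (suc q)) (s≤s (s≤s z≤n)) = hasPeriod-neg -[1+ c ] d first coprime q
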